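{- There is a polynomial-time $2$-approximation algorithm for budget-restrained makespan minimization (given a budget $b$, minimize the makespan among valid schedules with cost at most $b$) in Server Cloud Scheduling with arbitrary task graphs, when all communication delays are $0$ and the server and cloud machines are identical, i.e., $p_c(j)=p_s(j)$ for every job $j\notin\{s,t\}$.
   Context: Server Cloud Scheduling: the input is a directed acyclic task graph $G=(\mathcal{J},E)$ with exactly one source $s$ and one sink $t$; each job $j\in\mathcal{J}$ has a server processing time $p_s(j)\in\mathbb{N}_0$ and a cloud processing time $p_c(j)\in\mathbb{N}_0$, where $p_s(s)=p_s(t)=0$ and $p_c(s)=p_c(t)=\infty$; each edge $(i,j)\in E$ has a communication delay $c(i,j)\in\mathbb{N}_0$. There is one server machine (processing at most one job at a time) and unboundedly many cloud machines. A schedule is a partition $\mathcal{J}=\mathcal{J}_s\cup\mathcal{J}_c$ together with completion times $C:\mathcal{J}\to\mathbb{N}_0$; let $p_\pi(j)=p_s(j)$ if $j\in\mathcal{J}_s$ and $p_\pi(j)=p_c(j)$ if $j\in\mathcal{J}_c$. It is valid if (a) for distinct $i,j\in\mathcal{J}_s$: $C(i)\le C(j)-p_\pi(j)$ or $C(i)-p_\pi(i)\ge C(j)$; (b) for every edge $(i,j)$ with $i,j$ on the same side: $C(i)\le C(j)-p_\pi(j)$, and for every edge with $i,j$ on different sides: $C(i)+c(i,j)\le C(j)-p_\pi(j)$. The makespan is $C(t)$ and the cost is $\sum_{j\in\mathcal{J}_c}p_c(j)$. -}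

module Defs where

open import Data.Fin using (Fin; toℕ)
open import Data.List as List using (List; []; _∷_; _++_)
open import Data.Maybe using (Maybe; just; maybe; zipWith)
open import Data.Nat using (ℕ; zero; suc; _+_; _*_; _∸_; _≤_; _≟_)
open import Data.Nat.ListAction using (sum)
open import Data.Nat.Logarithm using (⌊log₂_⌋)
open import Data.Product using (Σ; ∃-syntax; _×_)
open import Data.Sum using (_⊎_)
open import Data.Vec.Functional using (foldr)
open import Relation.Binary.Construct.Closure.Transitive using (TransClosure)
open import Relation.Binary.Construct.Add.Supremum.NonStrict _≤_ using (_≤⁺_)
open import Relation.Binary.PropositionalEquality using (_≡_; _≢_)
open import Relation.Nullary using (¬_; yes; no)
open import Relation.Nullary.Construct.Add.Supremum using (_⁺; ⊤⁺; [_])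

------------------------------------------------------------------------
-- Server Cloud Scheduling

-- ℕ ∪ {∞}, where ∞ is ⊤⁺.
ℕ∞ : Set
ℕ∞ = ℕ ⁺

infixl 6 _⊕_

_⊕_ : ℕ∞ → ℕ∞ → ℕ∞
_⊕_ = zipWith _+_

record Instance : Set where
  field
    n  : ℕ

  Job : Set
  Job = Fin n

  field
    s t : Job
    pₛ  : Job → ℕ
    p꜀  : Job → ℕ∞
    -- c i j is just d if (i , j) is an edge with delay d, and nothing if
    -- (i , j) is not an edge.
    c   : Job → Job → Maybe ℕ

  E : Job → Job → Set
  E i j = ∃[ d ] c i j ≡ just d

  IsSource : Job → Set
  IsSource j = ∀ i → ¬ E i j

  IsSink : Job → Set
  IsSink i = ∀ j → ¬ E i j

  field
    acyclic       : ∀ j → ¬ TransClosure E j j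
    s-source      : IsSource s
    source-unique : ∀ j → IsSource j → j ≡ s
    t-sink        : IsSink t
    sink-unique   : ∀ j → IsSink j → j ≡ t
    pₛ-s          : pₛ s ≡ 0
    pₛ-t          : pₛ t ≡ 0
    p꜀-s          : p꜀ s ≡ ⊤⁺
    p꜀-t          : p꜀ t ≡ ⊤⁺
    p꜀-finite     : ∀ j → j ≢ s → j ≢ t → ∃[ m ] p꜀ j ≡ [ m ]

data Side : Set where
  server cloud : Side

record Schedule (n : ℕ) : Set where
  field
    side : Fin n → Side
    C    : Fin n → ℕ

module _ (I : Instance) where
  open Instance I

  module _ (π : Schedule n) where
    open Schedule π

    p[_] : Job → ℕ∞
    p[ j ] with side j
    ... | server = [ pₛ j ]
    ... | cloud  = p꜀ j

    -- x ≤ C(j) − p(j), the difference being taken in the integers (and −∞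
    -- if p(j) = ∞); truncated subtraction would give a weaker condition.
    _≤start_ : ℕ → Job → Set
    x ≤start j = [ x ] ⊕ p[ j ] ≤⁺ [ C j ]

    record Valid : Set where
      field
        server-disjoint : ∀ i j → i ≢ j → side i ≡ server → side j ≡ server →
                          (C i ≤start j) ⊎ (C j ≤start i)
        same-side       : ∀ i j → E i j → side i ≡ side j → C i ≤start j
        different-sides : ∀ i j d → c i j ≡ just d → side i ≢ side j →
                          (C i + d) ≤start j

    makespan : ℕ
    makespan = C t

    cloudCost : Job → ℕ∞
    cloudCost j with side j
    ... | server = [ 0 ]
    ... | cloud  = p꜀ j

    cost : ℕ∞
    cost = foldr _⊕_ [ 0 ] cloudCost

    FeasibleFor : ℕ → Set
    FeasibleFor b = Valid × cost ≤⁺ [ b ]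

  -- π is feasible for the budget b and its makespan is at most ρ times the
  -- minimum makespan of a schedule feasible for b.
  IsApproximation : (ρ b : ℕ) → Schedule n → Set
  IsApproximation ρ b π =
    FeasibleFor π b × (∀ π′ → FeasibleFor π′ b → makespan π ≤ ρ * makespan π′)

  ZeroDelays : Set
  ZeroDelays = ∀ i j d → c i j ≡ just d → d ≡ 0

  IdenticalMachines : Set
  IdenticalMachines = ∀ j → j ≢ s → j ≢ t → p꜀ j ≡ [ pₛ j ]

------------------------------------------------------------------------
-- The machine model: a random access machine with the logarithmic cost
-- criterion and structured control flow. The memory consists of arrays of
-- natural numbers. An array is named by a literal in the program text, so
-- a program has only finitely many; indices are computed at run time. The
-- only arithmetic operations are addition and truncated subtraction.

infixl 6 _⊞_ _⊟_
infix  8 _⟦_⟧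
infix  4 _⟦_⟧≔_
infixr 3 _⨟_

data Expr : Set where
  lit     : ℕ → Expr
  _⟦_⟧    : (array : ℕ) → Expr → Expr
  _⊞_ _⊟_ : Expr → Expr → Expr

data Program : Set where
  skip          : Program
  _⟦_⟧≔_        : (array : ℕ) → Expr → Expr → Program
  _⨟_           : Program → Program → Program
  if_then_else_ : Expr → Program → Program → Program
  while_loop_   : Expr → Program → Program

Memory : Set
Memory = ℕ → ℕ → ℕ

_[_,_↦_] : Memory → ℕ → ℕ → ℕ → Memory
(μ [ a , k ↦ v ]) a′ k′ with a ≟ a′ | k ≟ k′
... | yes _ | yes _ = v
... | _     | _     = μ a′ k′

-- The number of binary digits, with one digit for 0.
bits : ℕ → ℕ
bits x = suc ⌊log₂ x ⌋

eval : Memory → Expr → ℕ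
eval μ (lit x)    = x
eval μ (a ⟦ e ⟧)  = μ a (eval μ e)
eval μ (e₁ ⊞ e₂)  = eval μ e₁ + eval μ e₂
eval μ (e₁ ⊟ e₂)  = eval μ e₁ ∸ eval μ e₂

-- Each operation costs the total number of bits of the numbers it handles,
-- including the index of any array cell it accesses.
time : Memory → Expr → ℕ
time μ (lit x)    = bits x
time μ (a ⟦ e ⟧)  = time μ e + bits (eval μ e) + bits (μ a (eval μ e))
time μ (e₁ ⊞ e₂)  = time μ e₁ + time μ e₂ + bits (eval μ e₁) + bits (eval μ e₂)
time μ (e₁ ⊟ e₂)  = time μ e₁ + time μ e₂ + bits (eval μ e₁) + bits (eval μ e₂)

infix 2 ⟨_,_⟩⇓⟨_,_⟩

-- ⟨ P , μ ⟩⇓⟨ μ′ , k ⟩: run on memory μ, the program P halts with memory μ′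
-- after time k. A test succeeds if its value is nonzero.
data ⟨_,_⟩⇓⟨_,_⟩ : Program → Memory → Memory → ℕ → Set where
  skip : ∀ {μ} → ⟨ skip , μ ⟩⇓⟨ μ , 1 ⟩
  assign : ∀ {μ a e₁ e₂} →
    ⟨ a ⟦ e₁ ⟧≔ e₂ , μ ⟩⇓⟨ μ [ a , eval μ e₁ ↦ eval μ e₂ ] ,
      time μ e₁ + time μ e₂ + bits (eval μ e₁) + bits (eval μ e₂) ⟩
  seq : ∀ {P Q μ₀ μ₁ μ₂ k l} →
    ⟨ P , μ₀ ⟩⇓⟨ μ₁ , k ⟩ → ⟨ Q , μ₁ ⟩⇓⟨ μ₂ , l ⟩ →
    ⟨ P ⨟ Q , μ₀ ⟩⇓⟨ μ₂ , k + l ⟩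
  if-true : ∀ {e P Q μ₀ μ₁ k} →
    eval μ₀ e ≢ 0 → ⟨ P , μ₀ ⟩⇓⟨ μ₁ , k ⟩ →
    ⟨ if e then P else Q , μ₀ ⟩⇓⟨ μ₁ , time μ₀ e + bits (eval μ₀ e) + k ⟩
  if-false : ∀ {e P Q μ₀ μ₁ k} →
    eval μ₀ e ≡ 0 → ⟨ Q , μ₀ ⟩⇓⟨ μ₁ , k ⟩ →
    ⟨ if e then P else Q , μ₀ ⟩⇓⟨ μ₁ , time μ₀ e + bits (eval μ₀ e) + k ⟩
  while-true : ∀ {e P μ₀ μ₁ μ₂ k l} →
    eval μ₀ e ≢ 0 → ⟨ P , μ₀ ⟩⇓⟨ μ₁ , k ⟩ → ⟨ while e loop P , μ₁ ⟩⇓⟨ μ₂ , l ⟩ →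
    ⟨ while e loop P , μ₀ ⟩⇓⟨ μ₂ , time μ₀ e + bits (eval μ₀ e) + k + l ⟩
  while-false : ∀ {e P μ} →
    eval μ e ≡ 0 →
    ⟨ while e loop P , μ ⟩⇓⟨ μ , time μ e + bits (eval μ e) ⟩

------------------------------------------------------------------------
-- Input and output

-- The cells of a list, followed by zeros.
cells : List ℕ → ℕ → ℕ
cells []       _       = 0
cells (x ∷ _)  zero    = x
cells (_ ∷ xs) (suc k) = cells xs k

-- The input is placed in array 0.
load : List ℕ → Memory
load xs zero    = cells xs
load xs (suc _) = λ _ → 0

size : List ℕ → ℕ
size xs = sum (List.map bits xs)

-- nothing is encoded by 0 and just x by suc x. This covers both absent
-- edges and infinite processing times, since ⊤⁺ is nothing.
code : Maybe ℕ → ℕ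
code = maybe suc 0

encode : Instance → (b : ℕ) → List ℕ
encode I b =
  n ∷ toℕ s ∷ toℕ t ∷ b ∷
  List.tabulate pₛ ++
  List.tabulate (λ j → code (p꜀ j)) ++
  List.concat (List.tabulate λ i → List.tabulate λ j → code (c i j))
  where open Instance I

toSide : ℕ → Side
toSide zero    = server
toSide (suc _) = cloud

-- The side of job j is read from cell j of array 1, and its completion time
-- from cell j of array 2.
output : ∀ {n} → Memory → Schedule n
output μ = record
  { side = λ j → toSide (μ 1 (toℕ j))
  ; C    = λ j → μ 2 (toℕ j)
  }

-- A polynomial in one variable is given by its coefficients, constant
-- coefficient first.
evalPoly : List ℕ → ℕ → ℕ
evalPoly as x = List.foldr (λ a r → a + x * r) 0 as

-- P is an approximation algorithm with ratio ρ, running in time at most q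
-- of the input size, for the instances in the class K.
IsPolyTimeApproximationAlgorithm :
  (K : Instance → Set) (ρ : ℕ) (P : Program) (q : List ℕ) → Set
IsPolyTimeApproximationAlgorithm K ρ P q =
  ∀ (I : Instance) → K I → (b : ℕ) →
  Σ Memory λ μ → ∃[ k ]
    (⟨ P , load (encode I b) ⟩⇓⟨ μ , k ⟩)
    × k ≤ evalPoly q (size (encode I b))
    × IsApproximation I ρ b (output μ)

{-# OPTIONS --safe #-}
module Submission where

open import Defs
import Algebra.Properties.CommutativeMonoid.Sum
open import Data.Fin using (Fin; zero; suc; toℕ; fromℕ<)
import Data.Fin.Properties as Fin
open import Data.Fin.Induction using (spo-wellFounded; spo-noetherian)
open import Data.List as List using (List; []; _∷_; _++_)
open import Data.List.Properties using (map-++)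
open import Data.Maybe using (just; nothing)
open import Data.Maybe.Properties using (just-injective)
open import Data.Nat
open import Data.Nat.ListAction using () renaming (sum to listSum)
open import Data.Nat.ListAction.Properties using (sum-++)
open import Data.Nat.Logarithm using (⌊log₂⌋-mono-≤; ⌊log₂[2*b]⌋≡1+⌊log₂b⌋)
open import Data.Nat.Properties
open import Data.Nat.Tactic.RingSolver using (solve-∀)
open import Data.Product using (Σ; ∃-syntax; _×_; _,_; proj₁; proj₂)
open import Data.Sum using (_⊎_; inj₁; inj₂; [_,_]′)
open import Data.Unit using (⊤)
open import Data.Vec.Functional using (foldr)
open import Function using (_∘_; flip)
open import Induction.WellFounded using (WellFounded; Acc; acc; module Subrelation)
open import Relation.Binary.Construct.Add.Supremum.NonStrict _≤_ using (_≤⁺_; [_])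
import Relation.Binary.Construct.Closure.Transitive as Plus
open import Relation.Binary.Construct.Closure.Transitive using (TransClosure)
open import Relation.Binary.PropositionalEquality hiding ([_])
open import Relation.Binary.Structures using (IsStrictPartialOrder)
open import Relation.Nullary using (¬_; Dec; yes; no; contradiction)
open import Relation.Nullary.Construct.Add.Supremum using (⊤⁺) renaming ([_] to [_]⁺)
open import Relation.Nullary.Decidable using (False; toWitnessFalse; _×-dec_)

open Algebra.Properties.CommutativeMonoid.Sum +-0-commutativeMonoid
  using (sum; sum-cong-≗; ∑-distrib-+)

-- Let the head H j be the length of a longest path ending just before j.  The
-- algorithm runs through the jobs in an order that is topological and has
-- nondecreasing heads: in each of n rounds it takes the ready job of least head.
-- The job goes to the cloud if its processing time fits in the remaining budget
-- rem, and starts there when its predecessors are completed; otherwise it is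
-- appended to the server.  Let A be the load of the server so far.  Every job
-- appended to it is longer than rem, so by induction C j ≤ H j + p j + (A ∸ rem):
-- a server job on the critical path of j pays for the rem units saved.  At the
-- end, H t and A ∸ rem are both lower bounds for the makespan of any schedule π′
-- within the budget b, the latter because A + (b − rem) is the total load, of
-- which π′ sends at most b to the cloud.
--
-- For the running time, the program is written in a language of for-loops that
-- are repeated n times.  An operation of such a program adds a constant number of
-- bits to the largest number in memory, so both the numbers of digits and the
-- running time are polynomially bounded, by induction on the program.

-- Programs with bounded loops

update-at : ∀ μ a k v → (μ [ a , k ↦ v ]) a k ≡ v
update-at μ a k v with a ≟ a | k ≟ k
... | yes _ | yes _ = refl
... | no a≢a | _ = contradiction refl a≢a
... | yes _ | no k≢k = contradiction refl k≢k

update-array : ∀ μ {a a′} k v k′ → a ≢ a′ → (μ [ a , k ↦ v ]) a′ k′ ≡ μ a′ k′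
update-array μ {a} {a′} k v k′ a≢a′ with a ≟ a′ | k ≟ k′
... | yes a≡a′ | _ = contradiction a≡a′ a≢a′
... | no _ | _ = refl

update-index : ∀ μ a {k k′} v → k ≢ k′ → (μ [ a , k ↦ v ]) a k′ ≡ μ a k′
update-index μ a {k} {k′} v k≢k′ with a ≟ a | k ≟ k′
... | _ | yes k≡k′ = contradiction k≡k′ k≢k′
... | yes _ | no _ = refl
... | no _ | no _ = refl

infixr 3 _▹_
infix 4 _⟦_⟧←_

data Cmd : Set where
  nop               : Cmd
  _⟦_⟧←_            : (array : ℕ) → Expr → Expr → Cmd
  _▹_               : Cmd → Cmd → Cmd
  when_then_else_   : Expr → Cmd → Cmd → Cmd
  for_loop_         : (counter : ℕ) → Cmd → Cmd

var : ℕ → Expr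
var a = a ⟦ lit 0 ⟧

more : ℕ → Expr
more v = var 0 ⊟ var v

next : ℕ → Expr
next v = lit 1 ⊞ var v

-- The counter runs through 0, 1, …, n − 1, where n is cell 0 of array 0.
compile : Cmd → Program
compile nop                      = skip
compile (a ⟦ e₁ ⟧← e₂)           = a ⟦ e₁ ⟧≔ e₂
compile (P ▹ Q)                  = compile P ⨟ compile Q
compile (when e then P else Q)   = if e then compile P else compile Q
compile (for v loop P)           =
  v ⟦ lit 0 ⟧≔ lit 0 ⨟ while more v loop (compile P ⨟ v ⟦ lit 0 ⟧≔ next v)

branch : ∀ {A : Set} → ℕ → A → A → A
branch zero    x y = y
branch (suc _) x y = x

branch-elim : ∀ {A : Set} (Q : A → Set) m {x y : A} →
              (m ≢ 0 → Q x) → (m ≡ 0 → Q y) → Q (branch m x y)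
branch-elim Q zero    qx qy = qy refl
branch-elim Q (suc m) qx qy = qx λ ()

iter : ∀ {A : Set} → (A → A) → ℕ → A → A
iter f zero    x = x
iter f (suc k) x = f (iter f k x)

advance : ℕ → Memory → Memory
advance v μ = μ [ v , 0 ↦ suc (μ v 0) ]

den : Cmd → Memory → Memory
den nop                    μ = μ
den (a ⟦ e₁ ⟧← e₂)         μ = μ [ a , eval μ e₁ ↦ eval μ e₂ ]
den (P ▹ Q)                μ = den Q (den P μ)
den (when e then P else Q) μ = branch (eval μ e) (den P μ) (den Q μ)
den (for v loop P)         μ =
  iter (λ ν → advance v (den P ν)) (μ 0 0) (μ [ v , 0 ↦ 0 ])

-- The condition that a command never assigns to array `a`. Built from `False`, it computes to a
-- product of unit types for a concrete command, so its proofs are inferred from `_`.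
Fresh : ℕ → Cmd → Set
Fresh a nop                    = ⊤
Fresh a (a′ ⟦ e₁ ⟧← e₂)        = False (a′ ≟ a)
Fresh a (P ▹ Q)                = Fresh a P × Fresh a Q
Fresh a (when e then P else Q) = Fresh a P × Fresh a Q
Fresh a (for v loop P)         = False (v ≟ a) × Fresh a P

-- A loop body must leave its counter alone. Together with freshness of array 0 this makes the
-- compiled `while` stop after the intended number of rounds.
WellFormed : Cmd → Set
WellFormed nop                    = ⊤
WellFormed (a ⟦ e₁ ⟧← e₂)         = ⊤
WellFormed (P ▹ Q)                = WellFormed P × WellFormed Q
WellFormed (when e then P else Q) = WellFormed P × WellFormed Q
WellFormed (for v loop P)         = Fresh v P × WellFormed P

iter-invariant : ∀ {A : Set} (Q : ℕ → A → Set) {f : A → A} {x} →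
                 Q 0 x → (∀ k y → Q k y → Q (suc k) (f y)) → ∀ k → Q k (iter f k x)
iter-invariant Q q₀ q₊ zero    = q₀
iter-invariant Q q₀ q₊ (suc k) = q₊ k _ (iter-invariant Q q₀ q₊ k)

frame : ∀ P {a} → Fresh a P → ∀ μ k → den P μ a k ≡ μ a k
frame nop                    fr μ k = refl
frame (a′ ⟦ e₁ ⟧← e₂)        fr μ k = update-array μ _ _ k (toWitnessFalse fr)
frame (P ▹ Q)                (frP , frQ) μ k = trans (frame Q frQ (den P μ) k) (frame P frP μ k)
frame (when e then P else Q) {a} (frP , frQ) μ k =
  branch-elim (λ ν → ν a k ≡ μ a k) (eval μ e) {den P μ} {den Q μ} (λ _ → frame P frP μ k) (λ _ → frame Q frQ μ k)
frame (for v loop P) {a} (v≢a , frP) μ k =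
  iter-invariant (λ _ ν → ν a k ≡ μ a k) (update-array μ _ _ k (toWitnessFalse v≢a))
    (λ _ ν eq → trans (update-array (den P ν) _ _ k (toWitnessFalse v≢a)) (trans (frame P frP ν k) eq))
    (μ 0 0)

-- The loop rule. Each round may use that the counter is `i` and that every array not written by the
-- loop still has its content from before the loop.
for-invariant :
  ∀ {n} v P → Fresh v P → ∀ μ → μ 0 0 ≡ n → (Q : ℕ → Memory → Set) →
  Q 0 (μ [ v , 0 ↦ 0 ]) →
  (∀ (i : Fin n) ν → ν v 0 ≡ toℕ i → (∀ a → Fresh a (for v loop P) → ∀ k → ν a k ≡ μ a k) →
     Q (toℕ i) ν → Q (suc (toℕ i)) (advance v (den P ν))) →
  Q n (den (for v loop P) μ)
for-invariant v P fr μ refl Q q₀ q₊ =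
  proj₂ (proj₂ (iter-invariant Q′ start step (μ 0 0))) ≤-refl
  where
  Agree : Memory → Set
  Agree ν = ∀ a → Fresh a (for v loop P) → ∀ k → ν a k ≡ μ a k

  -- `iter-invariant` ranges over all `k`, but the preservation of `Q` is given only for rounds
  -- below the loop bound, hence the guard.
  Q′ : ℕ → Memory → Set
  Q′ k ν = ν v 0 ≡ k × Agree ν × (k ≤ μ 0 0 → Q k ν)

  start : Q′ 0 (μ [ v , 0 ↦ 0 ])
  start = update-at μ v 0 0 , (λ a fra k → update-array μ _ _ k (toWitnessFalse (proj₁ fra))) , λ _ → q₀

  step : ∀ k ν → Q′ k ν → Q′ (suc k) (advance v (den P ν))
  step k ν (eq , agree , q) =
    trans (update-at (den P ν) v 0 _) (cong suc (trans (frame P fr ν 0) eq)) ,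
    (λ a fra k → trans (update-array (den P ν) _ _ k (toWitnessFalse (proj₁ fra)))
                   (trans (frame P (proj₂ fra) ν k) (agree a fra k))) ,
    λ k<n → subst (λ m → Q (suc m) (advance v (den P ν))) (Fin.toℕ-fromℕ< k<n)
              (q₊ (fromℕ< k<n) ν (trans eq (sym (Fin.toℕ-fromℕ< k<n))) agree
                (subst (λ m → Q m ν) (sym (Fin.toℕ-fromℕ< k<n)) (q (<⇒≤ k<n))))

-- Polynomials

Poly : Set
Poly = List ℕ

infixl 6 _⊹_

_⊹_ : Poly → Poly → Poly
[]       ⊹ q        = q
(a ∷ p)  ⊹ []       = a ∷ p
(a ∷ p)  ⊹ (b ∷ q)  = a + b ∷ p ⊹ q

scale : ℕ → Poly → Poly
scale c = List.map (c *_)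

evalPoly-⊹ : ∀ p q x → evalPoly (p ⊹ q) x ≡ evalPoly p x + evalPoly q x
evalPoly-⊹ []      q       x = refl
evalPoly-⊹ (a ∷ p) []      x = sym (+-identityʳ _)
evalPoly-⊹ (a ∷ p) (b ∷ q) x rewrite evalPoly-⊹ p q x = lemma a b x (evalPoly p x) (evalPoly q x)
  where
  lemma : ∀ a b x y z → a + b + x * (y + z) ≡ a + x * y + (b + x * z)
  lemma = solve-∀

evalPoly-scale : ∀ c p x → evalPoly (scale c p) x ≡ c * evalPoly p x
evalPoly-scale c []      x = sym (*-zeroʳ c)
evalPoly-scale c (a ∷ p) x rewrite evalPoly-scale c p x = lemma c a x (evalPoly p x)
  where
  lemma : ∀ c a x y → c * a + x * (c * y) ≡ c * (a + x * y)
  lemma = solve-∀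

evalPoly-const : ∀ c x → evalPoly (c ∷ []) x ≡ c
evalPoly-const c x = trans (cong (c +_) (*-zeroʳ x)) (+-identityʳ c)

-- Widths

record Width (B : ℕ) (μ : Memory) : Set where
  constructor width
  field
    cell : ∀ a k → bits (μ a k) ≤ B

open Width

Width-mono : ∀ {B B′ μ} → B ≤ B′ → Width B μ → Width B′ μ
Width-mono B≤B′ W = width λ a k → ≤-trans (cell W a k) B≤B′

Width-update : ∀ {B μ v} a k → Width B μ → bits v ≤ B → Width B (μ [ a , k ↦ v ])
Width-update {B} {μ} {v} a k W bv = width update-cell
  where
  update-cell : ∀ a′ k′ → bits ((μ [ a , k ↦ v ]) a′ k′) ≤ B
  update-cell a′ k′ with a ≟ a′ | k ≟ k′
  ... | yes _ | yes _ = bv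
  ... | yes _ | no _  = cell W a′ k′
  ... | no _  | _     = cell W a′ k′

bits-mono : ∀ {x y} → x ≤ y → bits x ≤ bits y
bits-mono x≤y = s≤s (⌊log₂⌋-mono-≤ x≤y)

bits-double : ∀ {B} z → bits z ≤ B → bits (2 * z) ≤ suc B
bits-double zero    bz = m≤n⇒m≤1+n bz
bits-double (suc z) bz = s≤s (≤-trans (≤-reflexive (⌊log₂[2*b]⌋≡1+⌊log₂b⌋ (suc z))) bz)

-- The sum is at most twice the larger summand, and doubling adds one digit.
bits-+ : ∀ {B} x y → bits x ≤ B → bits y ≤ B → bits (x + y) ≤ suc B
bits-+ {B} x y bx by = ≤-trans (bits-mono x+y≤2z) (bits-double (x ⊔ y) bz)
  where
  x+y≤2z : x + y ≤ 2 * (x ⊔ y)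
  x+y≤2z = +-mono-≤ (m≤m⊔n x y) (≤-trans (m≤n⊔m x y) (m≤m+n _ 0))

  bz : bits (x ⊔ y) ≤ B
  bz = [ (λ eq → subst (λ z → bits z ≤ B) (sym eq) bx) , (λ eq → subst (λ z → bits z ≤ B) (sym eq) by) ]′ (⊔-sel x y)

-- One constant serves two bounds: on cells of at most `B` digits, evaluation yields at most
-- `B + weight e` digits and takes time at most `weight e * (B + weight e)`.
weight : Expr → ℕ
weight (lit x)   = bits x
weight (a ⟦ e ⟧) = 2 + weight e
weight (e₁ ⊞ e₂) = 2 + (weight e₁ + weight e₂)
weight (e₁ ⊟ e₂) = 2 + (weight e₁ + weight e₂)

eval-width : ∀ {B μ} → Width B μ → ∀ e → bits (eval μ e) ≤ B + weight e
eval-width W (lit x)   = m≤n+m _ _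
eval-width W (a ⟦ e ⟧) = ≤-trans (cell W a _) (m≤m+n _ _)
eval-width {B} {μ} W (e₁ ⊞ e₂) = ≤-trans
  (bits-+ (eval μ e₁) (eval μ e₂)
    (≤-trans (eval-width W e₁) (+-monoʳ-≤ B (m≤m+n (weight e₁) (weight e₂))))
    (≤-trans (eval-width W e₂) (+-monoʳ-≤ B (m≤n+m (weight e₂) (weight e₁)))))
  (≤-trans (≤-reflexive (sym (+-suc B _))) (+-monoʳ-≤ B (n≤1+n _)))
eval-width {B} {μ} W (e₁ ⊟ e₂) =
  ≤-trans (bits-mono (m∸n≤m (eval μ e₁) (eval μ e₂)))
    (≤-trans (eval-width W e₁) (+-monoʳ-≤ B (≤-trans (m≤m+n (weight e₁) (weight e₂)) (m≤n+m _ 2))))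

private
  binary-time : ∀ B u v {s t c d} →
    s ≤ u * (B + u) → t ≤ v * (B + v) → c ≤ B + u → d ≤ B + v →
    s + t + c + d ≤ (2 + (u + v)) * (B + (2 + (u + v)))
  binary-time B u v {s} {t} {c} {d} s≤ t≤ c≤ d≤ = begin
    s + t + c + d
      ≤⟨ +-mono-≤ (+-mono-≤ (+-mono-≤ (≤-trans s≤ (*-monoʳ-≤ u u≤)) (≤-trans t≤ (*-monoʳ-≤ v v≤)))
           (≤-trans c≤ u≤)) (≤-trans d≤ v≤) ⟩
    u * X + v * X + X + X
      ≡⟨ lemma u v X ⟩
    (2 + (u + v)) * X ∎
    where
    open ≤-Reasoning
    X = B + (2 + (u + v))
    u≤ : B + u ≤ X
    u≤ = +-monoʳ-≤ B (≤-trans (m≤m+n u v) (m≤n+m _ 2))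
    v≤ : B + v ≤ X
    v≤ = +-monoʳ-≤ B (≤-trans (m≤n+m v u) (m≤n+m _ 2))
    lemma : ∀ u v X → u * X + v * X + X + X ≡ (2 + (u + v)) * X
    lemma = solve-∀

time-bound : ∀ {B μ} → Width B μ → ∀ e → time μ e ≤ weight e * (B + weight e)
time-bound {B} W (lit x) = ≤-trans (m≤n+m _ B) (m≤m+n _ _)
time-bound {B} {μ} W (a ⟦ e ⟧) = begin
  time μ e + bits (eval μ e) + bits (μ a (eval μ e))
    ≤⟨ +-mono-≤ (+-mono-≤ (≤-trans (time-bound W e) (*-monoʳ-≤ w w≤)) (≤-trans (eval-width W e) w≤))
         (≤-trans (cell W a _) (m≤m+n B _)) ⟩
  w * X + X + X
    ≡⟨ lemma w X ⟩
  (2 + w) * X ∎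
  where
  open ≤-Reasoning
  w = weight e
  X = B + (2 + w)
  w≤ : B + w ≤ X
  w≤ = +-monoʳ-≤ B (m≤n+m _ 2)
  lemma : ∀ w X → w * X + X + X ≡ (2 + w) * X
  lemma = solve-∀
time-bound {B} W (e₁ ⊞ e₂) =
  binary-time B (weight e₁) (weight e₂) (time-bound W e₁) (time-bound W e₂) (eval-width W e₁) (eval-width W e₂)
time-bound {B} W (e₁ ⊟ e₂) =
  binary-time B (weight e₁) (weight e₂) (time-bound W e₁) (time-bound W e₂) (eval-width W e₁) (eval-width W e₂)

-- The extra unit in `suc (weight e)` pays for the digits of the value itself, which tests and
-- assignments charge on top of the evaluation.
exprTime : Expr → Poly → Poly
exprTime e B = scale (suc (weight e)) (B ⊹ (weight e ∷ []))

exprTime-bound : ∀ e B x {μ} → Width (evalPoly B x) μ →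
                 time μ e + bits (eval μ e) ≤ evalPoly (exprTime e B) x
exprTime-bound e B x {μ} W = begin
  time μ e + bits (eval μ e)           ≤⟨ +-mono-≤ (time-bound W e) (eval-width W e) ⟩
  w * (b + w) + (b + w)                ≡⟨ +-comm (w * (b + w)) _ ⟩
  suc w * (b + w)                      ≡⟨ cong (λ z → suc w * (b + z)) (evalPoly-const w x) ⟨
  suc w * (b + evalPoly (w ∷ []) x)    ≡⟨ cong (suc w *_) (evalPoly-⊹ B (w ∷ []) x) ⟨
  suc w * evalPoly (B ⊹ (w ∷ [])) x    ≡⟨ evalPoly-scale (suc w) (B ⊹ (w ∷ [])) x ⟨
  evalPoly (exprTime e B) x            ∎
  where
  open ≤-Reasoning
  w = weight e
  b = evalPoly B x

-- The number of digits added does not depend on the width at the start, so repeating a body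
-- multiplies its growth by the number of rounds instead of compounding it. In a loop the
-- coefficient `1` is for the digit of the initial counter 0.
growth : Cmd → Poly
growth nop                    = []
growth (a ⟦ e₁ ⟧← e₂)         = weight e₂ ∷ []
growth (P ▹ Q)                = growth P ⊹ growth Q
growth (when e then P else Q) = growth P ⊹ growth Q
growth (for v loop P)         = 1 ∷ growth P ⊹ (weight (next v) ∷ [])

step-width : ∀ v P x {B μ} → Width (B + evalPoly (growth P) x) (den P μ) →
  Width (B + evalPoly (growth P ⊹ (weight (next v) ∷ [])) x) (advance v (den P μ))
step-width v P x {B} {μ} W
  rewrite evalPoly-⊹ (growth P) (weight (next v) ∷ []) x
        | evalPoly-const (weight (next v)) x
        | sym (+-assoc B (evalPoly (growth P) x) (weight (next v)))
  = Width-update v 0 (Width-mono (m≤m+n _ _) W) (eval-width W (next v))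

den-width : ∀ P → Fresh 0 P → ∀ x {B μ} → μ 0 0 ≤ x → Width B μ →
            Width (B + evalPoly (growth P) x) (den P μ)

-- Cell 0 of array 0 is carried along because it bounds the loops nested in the body.
iter-width : ∀ v P → Fresh 0 (for v loop P) → ∀ x {B μ} → μ 0 0 ≤ x → Width B μ → ∀ k →
  let ν = iter (λ ν → advance v (den P ν)) k (μ [ v , 0 ↦ 0 ]) in
  ν 0 0 ≡ μ 0 0 × Width (B + (1 + k * evalPoly (growth P ⊹ (weight (next v) ∷ [])) x)) ν

den-width nop fr x {B} n≤x W = Width-mono (m≤m+n _ _) W
den-width (a ⟦ e₁ ⟧← e₂) fr x {B} {μ} n≤x W =
  Width-update a (eval μ e₁) (Width-mono (m≤m+n B _) W)
    (subst (λ c → bits (eval μ e₂) ≤ B + c) (sym (evalPoly-const (weight e₂) x)) (eval-width W e₂))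
den-width (P ▹ Q) (frP , frQ) x {B} {μ} n≤x W
  rewrite evalPoly-⊹ (growth P) (growth Q) x | sym (+-assoc B (evalPoly (growth P) x) (evalPoly (growth Q) x)) =
  den-width Q frQ x (subst (_≤ x) (sym (frame P frP μ 0)) n≤x) (den-width P frP x n≤x W)
den-width (when e then P else Q) (frP , frQ) x {B} {μ} n≤x W
  rewrite evalPoly-⊹ (growth P) (growth Q) x =
  branch-elim (Width _) (eval μ e)
    (λ _ → Width-mono (+-monoʳ-≤ B (m≤m+n _ _)) (den-width P frP x n≤x W))
    (λ _ → Width-mono (+-monoʳ-≤ B (m≤n+m _ _)) (den-width Q frQ x n≤x W))
den-width (for v loop P) fr x {B} {μ} n≤x W =
  Width-mono (+-monoʳ-≤ B (s≤s (*-monoˡ-≤ _ n≤x))) (proj₂ (iter-width v P fr x n≤x W (μ 0 0)))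

iter-width v P (v≢0 , frP) x {B} {μ} n≤x W = iter-invariant
  (λ k ν → ν 0 0 ≡ μ 0 0 × Width (B + (1 + k * g)) ν)
  (update-array μ 0 0 0 (toWitnessFalse v≢0) ,
   Width-update v 0 (Width-mono (m≤m+n B _) W) (m≤n+m _ B))
  (λ k ν (eq , Wν) →
    trans (update-array (den P ν) 0 _ 0 (toWitnessFalse v≢0)) (trans (frame P frP ν 0) eq) ,
    Width-mono (≤-reflexive (lemma B g (k * g)))
      (step-width v P x (den-width P frP x (subst (_≤ x) (sym eq) n≤x) Wν)))
  where
  g = evalPoly (growth P ⊹ (weight (next v) ∷ [])) x
  lemma : ∀ B g h → B + (1 + h) + g ≡ B + (1 + (g + h))
  lemma = solve-∀

-- Running time of compiled programs.

duration : Cmd → Poly → Poly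
duration nop                    B = 1 ∷ []
duration (a ⟦ e₁ ⟧← e₂)         B = exprTime e₁ B ⊹ exprTime e₂ B
duration (P ▹ Q)                B = duration P B ⊹ duration Q (B ⊹ growth P)
duration (when e then P else Q) B = exprTime e B ⊹ (duration P B ⊹ duration Q B)
duration (for v loop P)         B =
  exprTime (lit 0) B ⊹ exprTime (lit 0) B ⊹
  -- The coefficient `0` multiplies the cost of a round by the variable, which bounds the number of
  -- rounds; the last summand is the failing test.
  ((0 ∷ exprTime (more v) B′ ⊹ (duration P B′ ⊹ (exprTime (lit 0) B″ ⊹ exprTime (next v) B″))) ⊹ exprTime (more v) B′)
  where
  B′ = B ⊹ growth (for v loop P)
  B″ = B′ ⊹ growth P

Runs : Program → Memory → Memory → ℕ → Set
Runs P μ ν T = ∃[ k ] (⟨ P , μ ⟩⇓⟨ ν , k ⟩) × k ≤ T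

assign-runs : ∀ a e₁ e₂ B x {μ} → Width (evalPoly B x) μ →
  Runs (a ⟦ e₁ ⟧≔ e₂) μ (μ [ a , eval μ e₁ ↦ eval μ e₂ ]) (evalPoly (exprTime e₁ B ⊹ exprTime e₂ B) x)
assign-runs a e₁ e₂ B x {μ} W = _ , assign , (begin
  time μ e₁ + time μ e₂ + bits (eval μ e₁) + bits (eval μ e₂)
    ≡⟨ lemma (time μ e₁) (time μ e₂) (bits (eval μ e₁)) (bits (eval μ e₂)) ⟩
  time μ e₁ + bits (eval μ e₁) + (time μ e₂ + bits (eval μ e₂))
    ≤⟨ +-mono-≤ (exprTime-bound e₁ B x W) (exprTime-bound e₂ B x W) ⟩
  evalPoly (exprTime e₁ B) x + evalPoly (exprTime e₂ B) x
    ≡⟨ evalPoly-⊹ (exprTime e₁ B) (exprTime e₂ B) x ⟨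
  evalPoly (exprTime e₁ B ⊹ exprTime e₂ B) x ∎)
  where
  open ≤-Reasoning
  lemma : ∀ a b c d → a + b + c + d ≡ a + c + (b + d)
  lemma = solve-∀

-- `g k` is the memory after `k` rounds. The induction is on the number `m` of rounds left; the
-- separate summand `S` pays for the test that fails.
while-runs : ∀ {e P n S T} (g : ℕ → Memory) →
  (∀ k → k ≤ n → time (g k) e + bits (eval (g k) e) ≤ S) →
  (∀ k → k < n → eval (g k) e ≢ 0) → eval (g n) e ≡ 0 →
  (∀ k → k < n → Runs P (g k) (g (suc k)) T) →
  ∀ m k → m + k ≡ n → Runs (while e loop P) (g k) (g n) (m * (S + T) + S)
while-runs g test true false body zero k refl = _ , while-false false , test k ≤-refl
while-runs {S = S} {T} g test true false body (suc m) k refl =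
  let k<n = m<n+m k z<s
      l₁ , run₁ , l₁≤ = body k k<n
      l₂ , run₂ , l₂≤ = while-runs g test true false body m (suc k) (+-suc m k)
  in _ , while-true (true k k<n) run₁ run₂ ,
     ≤-trans (+-mono-≤ (+-mono-≤ (test k (<⇒≤ k<n)) l₁≤) l₂≤) (≤-reflexive (lemma S T (m * (S + T))))
  where
  lemma : ∀ S T M → S + T + (M + S) ≡ S + T + M + S
  lemma = solve-∀

seq-runs : ∀ {P Q μ₀ μ₁ μ₂ S T} → Runs P μ₀ μ₁ S → Runs Q μ₁ μ₂ T → Runs (P ⨟ Q) μ₀ μ₂ (S + T)
seq-runs (k , r , k≤) (l , r′ , l≤) = k + l , seq r r′ , +-mono-≤ k≤ l≤

-- Charging for both branches keeps the bound independent of the test. The test value is a variable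
-- `m`, so that matching on it reduces `branch`.
if-runs : ∀ {P Q μ ν₁ ν₂ S T U} e m → eval μ e ≡ m → time μ e + bits (eval μ e) ≤ S →
          Runs P μ ν₁ T → Runs Q μ ν₂ U → Runs (if e then P else Q) μ (branch m ν₁ ν₂) (S + (T + U))
if-runs e zero    eq t≤ _ (l , r , l≤) =
  _ , if-false eq r , +-mono-≤ t≤ (≤-trans l≤ (m≤n+m _ _))
if-runs e (suc m) eq t≤ (k , r , k≤) _ =
  _ , if-true (λ eq′ → 1+n≢0 (trans (sym eq) eq′)) r , +-mono-≤ t≤ (≤-trans k≤ (m≤m+n _ _))

weaken : ∀ {P μ ν S T} → S ≤ T → Runs P μ ν S → Runs P μ ν T
weaken S≤T (k , r , k≤) = k , r , ≤-trans k≤ S≤T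

runs : ∀ P → WellFormed P → Fresh 0 P → ∀ B x {μ} → μ 0 0 ≤ x → Width (evalPoly B x) μ →
       Runs (compile P) μ (den P μ) (evalPoly (duration P B) x)
runs nop wf fr B x n≤x W = 1 , skip , m≤m+n 1 _
runs (a ⟦ e₁ ⟧← e₂) wf fr B x n≤x W = assign-runs a e₁ e₂ B x W
runs (P ▹ Q) (wfP , wfQ) (frP , frQ) B x {μ} n≤x W =
  weaken (≤-reflexive (sym (evalPoly-⊹ (duration P B) _ x)))
    (seq-runs (runs P wfP frP B x n≤x W)
      (runs Q wfQ frQ (B ⊹ growth P) x (subst (_≤ x) (sym (frame P frP μ 0)) n≤x)
        (Width-mono (≤-reflexive (sym (evalPoly-⊹ B (growth P) x))) (den-width P frP x n≤x W))))
runs (when e then P else Q) (wfP , wfQ) (frP , frQ) B x {μ} n≤x W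
  rewrite evalPoly-⊹ (exprTime e B) (duration P B ⊹ duration Q B) x
        | evalPoly-⊹ (duration P B) (duration Q B) x
  = if-runs e (eval μ e) refl (exprTime-bound e B x W)
      (runs P wfP frP B x n≤x W) (runs Q wfQ frQ B x n≤x W)
runs (for v loop P) (frv , wfP) fr@(v≢0 , frP) B x {μ} n≤x W = weaken total
  (seq-runs (assign-runs v (lit 0) (lit 0) B x W)
    (while-runs (λ k → iter (λ ν → advance v (den P ν)) k (μ [ v , 0 ↦ 0 ]))
      (λ k k≤n → exprTime-bound (more v) B′ x (width′ k k≤n))
      -- The test computes the number of rounds left.
      (λ k k<n → subst (_≢ 0) (sym (cong₂ _∸_ (zero-cell k) (counter k))) (m>n⇒m∸n≢0 k<n))
      (trans (cong₂ _∸_ (zero-cell (μ 0 0)) (counter (μ 0 0))) (n∸n≡0 (μ 0 0)))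
      (λ k k<n → let n≤x′ = subst (_≤ x) (sym (zero-cell k)) n≤x in
        seq-runs (runs P wfP frP B′ x n≤x′ (width′ k (<⇒≤ k<n)))
          (assign-runs v (lit 0) (next v) B″ x
            (Width-mono (≤-reflexive (sym (evalPoly-⊹ B′ (growth P) x)))
              (den-width P frP x n≤x′ (width′ k (<⇒≤ k<n))))))
      (μ 0 0) 0 (+-identityʳ _)))
  where
  B′ = B ⊹ growth (for v loop P)
  B″ = B′ ⊹ growth P
  g = λ k → iter (λ ν → advance v (den P ν)) k (μ [ v , 0 ↦ 0 ])

  zero-cell : ∀ k → g k 0 0 ≡ μ 0 0
  zero-cell k = proj₁ (iter-width v P fr x n≤x W k)

  counter : ∀ k → g k v 0 ≡ k
  counter = iter-invariant (λ k ν → ν v 0 ≡ k) (update-at μ v 0 0)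
    (λ k ν eq → trans (update-at (den P ν) v 0 _) (cong suc (trans (frame P frv ν 0) eq)))

  width′ : ∀ k → k ≤ μ 0 0 → Width (evalPoly B′ x) (g k)
  width′ k k≤n = Width-mono
    (≤-trans (+-monoʳ-≤ (evalPoly B x) (s≤s (*-monoˡ-≤ _ (≤-trans k≤n n≤x))))
      (≤-reflexive (sym (evalPoly-⊹ B (growth (for v loop P)) x))))
    (proj₂ (iter-width v P fr x n≤x W k))

  init = exprTime (lit 0) B ⊹ exprTime (lit 0) B
  test = exprTime (more v) B′
  inc  = exprTime (lit 0) B″ ⊹ exprTime (next v) B″

  total : evalPoly init x +
            (μ 0 0 * (evalPoly test x + (evalPoly (duration P B′) x + evalPoly inc x)) + evalPoly test x)
          ≤ evalPoly (duration (for v loop P) B) x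
  total rewrite evalPoly-⊹ init ((0 ∷ test ⊹ (duration P B′ ⊹ inc)) ⊹ test) x
              | evalPoly-⊹ (0 ∷ test ⊹ (duration P B′ ⊹ inc)) test x
              | evalPoly-⊹ test (duration P B′ ⊹ inc) x
              | evalPoly-⊹ (duration P B′) inc x
    = +-monoʳ-≤ (evalPoly init x) (+-monoˡ-≤ (evalPoly test x) (*-monoˡ-≤ _ n≤x))

-- Sums, packings and maxima

sum-update : ∀ {m} (f g : Fin m → ℕ) j → f j ≡ 0 → (∀ i → i ≢ j → g i ≡ f i) →
             sum g ≡ g j + sum f
sum-update f g zero fj≡0 same rewrite fj≡0 =
  cong (g zero +_) (sum-cong-≗ λ i → same (suc i) λ ())
sum-update f g (suc j) fj≡0 same
  rewrite same zero (λ ())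
        | sum-update (f ∘ suc) (g ∘ suc) j fj≡0 (λ i i≢j → same (suc i) (i≢j ∘ Fin.suc-injective))
  = lemma (f zero) (g (suc j)) _
  where
  lemma : ∀ a b c → a + (b + c) ≡ b + (a + c)
  lemma = solve-∀

sum-zero : ∀ {m} (f : Fin m → ℕ) → (∀ i → f i ≡ 0) → sum f ≡ 0
sum-zero {zero}  f f≡0 = refl
sum-zero {suc m} f f≡0 = cong₂ _+_ (f≡0 zero) (sum-zero (f ∘ suc) (f≡0 ∘ suc))

sum≤n : ∀ {m} (f : Fin m → ℕ) → (∀ i → f i ≤ 1) → sum f ≤ m
sum≤n {zero}  f f≤1 = z≤n
sum≤n {suc m} f f≤1 = +-mono-≤ (f≤1 zero) (sum≤n (f ∘ suc) (f≤1 ∘ suc))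

-- With `sum≥n`, turns a count of finished jobs into the absence or existence of unfinished ones.
sum<n : ∀ {m} (f : Fin m → ℕ) → (∀ i → f i ≤ 1) → ∀ j → f j ≡ 0 → sum f < m
sum<n f f≤1 zero    fj≡0 rewrite fj≡0 = s≤s (sum≤n (f ∘ suc) (f≤1 ∘ suc))
sum<n f f≤1 (suc j) fj≡0 = +-mono-≤-< (f≤1 zero) (sum<n (f ∘ suc) (f≤1 ∘ suc) j fj≡0)

sum≥n : ∀ {m} (f : Fin m → ℕ) → (∀ i → f i ≢ 0) → m ≤ sum f
sum≥n {zero}  f f≢0 = z≤n
sum≥n {suc m} f f≢0 = +-mono-≤ (n≢0⇒n>0 (f≢0 zero)) (sum≥n (f ∘ suc) (f≢0 ∘ suc))

≤1∧≢0⇒≡1 : ∀ {m} → m ≤ 1 → m ≢ 0 → m ≡ 1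
≤1∧≢0⇒≡1 z≤n       m≢0 = contradiction refl m≢0
≤1∧≢0⇒≡1 (s≤s z≤n) m≢0 = refl

serverLoad cloudLoad : Side → ℕ → ℕ
serverLoad server p = p
serverLoad cloud  p = 0
cloudLoad server p = 0
cloudLoad cloud  p = p

-- The interval of job j is (C j − p j , C j].  The induction deletes job 0 and
-- moves the intervals behind it forward by p 0.
packing : ∀ {m} (σ : Fin m → Side) (p C : Fin m → ℕ) T →
  (∀ i j → i ≢ j → σ i ≡ server → σ j ≡ server → C i + p j ≤ C j ⊎ C j + p i ≤ C i) →
  (∀ i → σ i ≡ server → p i ≤ C i) → (∀ i → σ i ≡ server → C i ≤ T) →
  sum (λ i → serverLoad (σ i) (p i)) ≤ T
packing {zero}  σ p C T disjoint p≤C C≤T = z≤n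
packing {suc m} σ p C T disjoint p≤C C≤T with σ zero in σ₀
... | cloud = packing (σ ∘ suc) (p ∘ suc) (C ∘ suc) T
        (λ i j i≢j → disjoint (suc i) (suc j) (i≢j ∘ Fin.suc-injective)) (p≤C ∘ suc) (C≤T ∘ suc)
... | server = begin
  p₀ + sum (λ i → serverLoad (σ (suc i)) (p (suc i)))
    ≤⟨ +-monoʳ-≤ p₀ (packing (σ ∘ suc) (p ∘ suc) C′ (T ∸ p₀) disjoint′ p≤C′ C′≤T) ⟩
  p₀ + (T ∸ p₀)
    ≡⟨ m+[n∸m]≡n (≤-trans p₀≤C₀ (C≤T zero σ₀)) ⟩
  T ∎
  where
  open ≤-Reasoning
  p₀ = p zero
  C₀ = C zero

  p₀≤C₀ : p₀ ≤ C₀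
  p₀≤C₀ = p≤C zero σ₀

  C′ : Fin m → ℕ
  C′ j with C₀ + p (suc j) ≤? C (suc j)
  ... | yes _ = C (suc j) ∸ p₀
  ... | no  _ = C (suc j)

  After Before : Fin m → Set
  After  j = C₀ + p (suc j) ≤ C (suc j) × C′ j ≡ C (suc j) ∸ p₀
  Before j = C (suc j) + p₀ ≤ C₀ × C′ j ≡ C (suc j)

  position : ∀ j → σ (suc j) ≡ server → After j ⊎ Before j
  position j σⱼ with C₀ + p (suc j) ≤? C (suc j) | disjoint zero (suc j) (λ ()) σ₀ σⱼ
  ... | yes after | _           = inj₁ (after , refl)
  ... | no ¬after | inj₁ after  = contradiction after ¬after
  ... | no _      | inj₂ before = inj₂ (before , refl)

  p₀≤ : ∀ {j} → After j → p₀ + p (suc j) ≤ C (suc j)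
  p₀≤ (after , _) = ≤-trans (+-monoˡ-≤ _ p₀≤C₀) after

  p≤C′ : ∀ j → σ (suc j) ≡ server → p (suc j) ≤ C′ j
  p≤C′ j σⱼ with position j σⱼ
  ... | inj₁ a@(_ , eq) rewrite eq = m+n≤o⇒m≤o∸n _ (subst (_≤ C (suc j)) (+-comm p₀ (p (suc j))) (p₀≤ a))
  ... | inj₂ (_ , eq) rewrite eq = p≤C (suc j) σⱼ

  C′≤T : ∀ j → σ (suc j) ≡ server → C′ j ≤ T ∸ p₀
  C′≤T j σⱼ with position j σⱼ
  ... | inj₁ (_ , eq) rewrite eq = ∸-monoˡ-≤ p₀ (C≤T (suc j) σⱼ)
  ... | inj₂ (before , eq) rewrite eq = m+n≤o⇒m≤o∸n _ (≤-trans before (C≤T zero σ₀))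

  -- A job before job 0 ends by `C₀ ∸ p₀` and one behind it starts no earlier than `C₀`, so the
  -- shift by `p₀` only fills the gap left by job 0.
  after-before : ∀ i j → After i → Before j → C′ j + p (suc i) ≤ C′ i
  after-before i j (after , eqᵢ) (before , eqⱼ) rewrite eqᵢ | eqⱼ = m+n≤o⇒m≤o∸n _ (begin
    C (suc j) + p (suc i) + p₀   ≡⟨ lemma (C (suc j)) (p (suc i)) p₀ ⟩
    C (suc j) + p₀ + p (suc i)   ≤⟨ +-monoˡ-≤ _ before ⟩
    C₀ + p (suc i)               ≤⟨ after ⟩
    C (suc i)                    ∎)
    where
    lemma : ∀ a b c → a + b + c ≡ a + c + b
    lemma = solve-∀

  after-after : ∀ i j → After i → After j → C (suc i) + p (suc j) ≤ C (suc j) → C′ i + p (suc j) ≤ C′ j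
  after-after i j aᵢ@(_ , eqᵢ) (_ , eqⱼ) le rewrite eqᵢ | eqⱼ =
    ≤-trans (≤-reflexive (sym (+-∸-comm (p (suc j)) (m+n≤o⇒m≤o p₀ (p₀≤ aᵢ))))) (∸-monoˡ-≤ p₀ le)

  disjoint′ : ∀ i j → i ≢ j → σ (suc i) ≡ server → σ (suc j) ≡ server →
              C′ i + p (suc j) ≤ C′ j ⊎ C′ j + p (suc i) ≤ C′ i
  disjoint′ i j i≢j σᵢ σⱼ
    with position i σᵢ | position j σⱼ
       | disjoint (suc i) (suc j) (i≢j ∘ Fin.suc-injective) σᵢ σⱼ
  ... | inj₁ a | inj₂ b | _ = inj₂ (after-before i j a b)
  ... | inj₂ b | inj₁ a | _ = inj₁ (after-before j i a b)
  ... | inj₁ a | inj₁ a′ | inj₁ le = inj₁ (after-after i j a a′ le)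
  ... | inj₁ a | inj₁ a′ | inj₂ le = inj₂ (after-after j i a′ a le)
  ... | inj₂ (_ , eqᵢ) | inj₂ (_ , eqⱼ) | le rewrite eqᵢ | eqⱼ = le

-- Maxima of natural numbers; the maximum of the empty family is 0.
IsMax : ∀ {A : Set} → (A → Set) → (A → ℕ) → ℕ → Set
IsMax P f m = (∀ i → P i → f i ≤ m) × (∀ x → (∀ i → P i → f i ≤ x) → m ≤ x)

IsMax-cong : ∀ {A : Set} {P : A → Set} {f g m} → (∀ i → P i → f i ≡ g i) → IsMax P f m → IsMax P g m
IsMax-cong eq (upper , least) =
  (λ i Pi → subst (_≤ _) (eq i Pi) (upper i Pi)) ,
  (λ x g≤x → least x λ i Pi → subst (_≤ x) (sym (eq i Pi)) (g≤x i Pi))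

⊕-finite : ∀ {x y b} → x ⊕ y ≤⁺ [ b ]⁺ → ∃[ u ] ∃[ v ] x ≡ just u × y ≡ just v × u + v ≤ b
⊕-finite {just u} {just v} [ le ] = u , v , refl , refl , le

-- A single infinite summand would make the whole sum infinite, so a bounded cost comes from a
-- family of natural numbers.
foldr-⊕-finite : ∀ {m b} (f : Fin m → ℕ∞) → foldr _⊕_ [ 0 ]⁺ f ≤⁺ [ b ]⁺ →
                 ∃[ g ] (∀ j → f j ≡ [ g j ]⁺) × sum g ≤ b
foldr-⊕-finite {zero}  f le = (λ ()) , (λ ()) , z≤n
foldr-⊕-finite {suc m} f le with ⊕-finite le
... | u , v , fu , fv , u+v≤b with foldr-⊕-finite {b = v} (f ∘ suc) (subst (_≤⁺ [ v ]⁺) (sym fv) [ ≤-refl ])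
...   | g , eq , g≤v = (λ { zero → u ; (suc j) → g j }) , (λ { zero → fu ; (suc j) → eq j }) ,
                       ≤-trans (+-monoʳ-≤ u g≤v) u+v≤b

foldr-⊕-just : ∀ {m} (f : Fin m → ℕ∞) g → (∀ j → f j ≡ [ g j ]⁺) → foldr _⊕_ [ 0 ]⁺ f ≡ [ sum g ]⁺
foldr-⊕-just {zero}  f g eq = refl
foldr-⊕-just {suc m} f g eq = cong₂ _⊕_ (eq zero) (foldr-⊕-just (f ∘ suc) (g ∘ suc) (eq ∘ suc))

side-≟ : (σ τ : Side) → Dec (σ ≡ τ)
side-≟ server server = yes refl
side-≟ server cloud  = no λ ()
side-≟ cloud  server = no λ ()
side-≟ cloud  cloud  = yes refl

-- The task graph, and lower bounds for the makespan of feasible schedules.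

module Graph (I : Instance) where
  open Instance I

  E? : ∀ i j → Dec (E i j)
  E? i j with c i j
  ... | just d  = yes (d , refl)
  ... | nothing = no λ ()

  -- Acyclicity is irreflexivity of the transitive closure. On a finite set such an order is
  -- well-founded in both directions, which allows induction along edges both ways.
  E⁺-isStrictPartialOrder : IsStrictPartialOrder _≡_ (TransClosure E)
  E⁺-isStrictPartialOrder = record
    { isEquivalence = isEquivalence
    ; irrefl        = λ { refl → acyclic _ }
    ; trans         = Plus.transitive E
    ; <-resp-≈      = resp₂ (TransClosure E)
    }

  E-wellFounded : WellFounded E
  E-wellFounded = Subrelation.wellFounded Plus.[_] (spo-wellFounded E⁺-isStrictPartialOrder)

  E-noetherian : WellFounded (flip E)
  E-noetherian = Subrelation.wellFounded Plus.[_] (spo-noetherian E⁺-isStrictPartialOrder)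

  -- Following edges forward from any job must stop, and it can stop only at the unique sink.
  max-at-sink : ∀ (C : Job → ℕ) → (∀ i j → E i j → C i ≤ C j) → ∀ j → C j ≤ C t
  max-at-sink C mono j = go (E-noetherian j)
    where
    go : ∀ {j} → Acc (flip E) j → C j ≤ C t
    go {j} (acc rs) with Fin.any? (E? j)
    ... | yes (k , e) = ≤-trans (mono j k e) (go (rs e))
    ... | no none     = ≤-reflexive (cong C (sink-unique j λ k e → none (k , e)))

  p-finite : ∀ π j → (Schedule.side π j ≡ cloud → p꜀ j ≡ [ pₛ j ]⁺) → p[_] I π j ≡ [ pₛ j ]⁺
  p-finite π j eq with Schedule.side π j
  ... | server = refl
  ... | cloud  = eq refl

  cloudCost-finite : ∀ π j → (Schedule.side π j ≡ cloud → p꜀ j ≡ [ pₛ j ]⁺) →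
                     cloudCost I π j ≡ [ cloudLoad (Schedule.side π j) (pₛ j) ]⁺
  cloudCost-finite π j eq with Schedule.side π j
  ... | server = refl
  ... | cloud  = eq refl

  cloudCost-cloud : ∀ π j → Schedule.side π j ≡ cloud → cloudCost I π j ≡ p꜀ j
  cloudCost-cloud π j σ with Schedule.side π j
  cloudCost-cloud π j refl | cloud = refl

  load-split : ∀ (σ : Job → Side) →
    sum pₛ ≡ sum (λ j → serverLoad (σ j) (pₛ j)) + sum (λ j → cloudLoad (σ j) (pₛ j))
  load-split σ = trans (sum-cong-≗ λ j → split (σ j) (pₛ j)) (∑-distrib-+ (λ j → serverLoad (σ j) (pₛ j)) (λ j → cloudLoad (σ j) (pₛ j)))
    where
    split : ∀ τ p → p ≡ serverLoad τ p + cloudLoad τ p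
    split server p = sym (+-identityʳ p)
    split cloud  p = refl

  module LowerBounds (zeroDelays : ZeroDelays I) (identical : IdenticalMachines I)
                     {b} (π : Schedule n) (feasible : FeasibleFor I π b) where
    open Schedule π
    open Valid (proj₁ feasible)

    costs : ∃[ g ] (∀ j → cloudCost I π j ≡ [ g j ]⁺) × sum g ≤ b
    costs = foldr-⊕-finite (cloudCost I π) (proj₂ feasible)

    -- Its cloud cost would be infinite, but the total is within the budget.
    infinite⇒server : ∀ j → p꜀ j ≡ ⊤⁺ → side j ≢ cloud
    infinite⇒server j ∞ σ with trans (sym (proj₁ (proj₂ costs) j)) (trans (cloudCost-cloud π j σ) ∞)
    ... | ()

    cloud⇒finite : ∀ j → side j ≡ cloud → p꜀ j ≡ [ pₛ j ]⁺
    cloud⇒finite j σ = identical j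
      (λ { refl → infinite⇒server j p꜀-s σ }) (λ { refl → infinite⇒server j p꜀-t σ })

    start-≤ : ∀ {x} j → _≤start_ I π x j → x + pₛ j ≤ C j
    start-≤ j le with subst (λ q → [ _ ]⁺ ⊕ q ≤⁺ [ C j ]⁺) (p-finite π j (cloud⇒finite j)) le
    ... | [ le′ ] = le′

    edge-≤ : ∀ i j → E i j → C i + pₛ j ≤ C j
    edge-≤ i j e@(d , cij) with side-≟ (side i) (side j)
    ... | yes eq = start-≤ j (same-side i j e eq)
    ... | no neq with zeroDelays i j d cij
    ...   | refl = subst (λ x → x + pₛ j ≤ C j) (+-identityʳ (C i)) (start-≤ j (different-sides i j 0 cij neq))

    -- A job with a predecessor starts no earlier than the predecessor's completion time, which is a
    -- natural number; the only job without one is `s`, of length 0.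
    p≤C : ∀ j → pₛ j ≤ C j
    p≤C j with Fin.any? (λ i → E? i j)
    ... | yes (i , e) = ≤-trans (m≤n+m _ (C i)) (edge-≤ i j e)
    ... | no none with source-unique j (λ i e → none (i , e))
    ...   | refl = subst (_≤ C j) (sym pₛ-s) z≤n

    -- The server part is packed into the time up to `C t`, and the cloud part is the cost.
    total-load : sum pₛ ≤ C t + b
    total-load = begin
      sum pₛ
        ≡⟨ load-split side ⟩
      sum (λ j → serverLoad (side j) (pₛ j)) + sum (λ j → cloudLoad (side j) (pₛ j))
        ≤⟨ +-mono-≤
             (packing side pₛ C (C t)
               (λ i j i≢j σᵢ σⱼ →
                 [ (λ le → inj₁ (start-≤ j le)) , (λ le → inj₂ (start-≤ i le)) ]′ (server-disjoint i j i≢j σᵢ σⱼ))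
               (λ j _ → p≤C j)
               (λ j _ → max-at-sink C (λ i j e → ≤-trans (m≤m+n _ _) (edge-≤ i j e)) j))
             (≤-trans (≤-reflexive (sum-cong-≗ λ j → just-injective
               (trans (sym (cloudCost-finite π j (cloud⇒finite j))) (proj₁ (proj₂ costs) j))))
               (proj₂ (proj₂ costs))) ⟩
      C t + b ∎
      where open ≤-Reasoning

    -- By induction `H i + pₛ i ≤ C i` for each predecessor `i`, so the start time `C j ∸ pₛ j` is
    -- an upper bound of the family whose maximum is `H j`.
    head-≤ : ∀ (H : Job → ℕ) → (∀ j → IsMax (λ i → E i j) (λ i → H i + pₛ i) (H j)) → ∀ j → H j + pₛ j ≤ C j
    head-≤ H heads j = go (E-wellFounded j)
      where
      go : ∀ {j} → Acc E j → H j + pₛ j ≤ C j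
      go {j} (acc rs) = subst (H j + pₛ j ≤_) (m∸n+n≡m (p≤C j)) (+-monoˡ-≤ (pₛ j)
        (proj₂ (heads j) (C j ∸ pₛ j) λ i e → ≤-trans (go (rs e)) (m+n≤o⇒m≤o∸n _ (edge-≤ i j e))))

-- The greedy invariant

-- All values are natural numbers, so that a state can be read off the memory: `done` and `side` are
-- flags, `H` holds the heads, `rem` is the unspent budget.
record State (n : ℕ) : Set where
  field
    done side C H : Fin n → ℕ
    rem F         : ℕ

schedule : ∀ {n} → State n → Schedule n
schedule st = record { side = λ j → toSide (State.side st j) ; C = State.C st }

doneServerLoad doneCloudLoad : (done side p : ℕ) → ℕ
doneServerLoad zero    _ p = 0
doneServerLoad (suc _) σ p = serverLoad (toSide σ) p
doneCloudLoad zero    _ p = 0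
doneCloudLoad (suc _) σ p = cloudLoad (toSide σ) p

Updated : ∀ {n} → (Fin n → ℕ) → Fin n → ℕ → (Fin n → ℕ) → Set
Updated f j v f′ = f′ j ≡ v × (∀ i → i ≢ j → f′ i ≡ f i)

module Invariant (I : Instance) (b : ℕ) where
  open Instance I
  open Graph I

  module _ (st : State n) where
    open State st

    Done Ready : Job → Set
    Done j = done j ≡ 1
    Ready j = done j ≡ 0 × (∀ i → E i j → Done i)

    -- These are the jobs other than `s` and `t`, described by a value that the program can test.
    Inner : Job → Set
    Inner j = p꜀ j ≢ ⊤⁺

    IsHead : Job → ℕ → Set
    IsHead j = IsMax (λ i → E i j) (λ i → H i + pₛ i)

    IsRelease : Job → ℕ → Set
    IsRelease j = IsMax (λ i → E i j) C

    A : ℕ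
    A = sum λ j → doneServerLoad (done j) (side j) (pₛ j)

    B : ℕ
    B = sum λ j → doneCloudLoad (done j) (side j) (pₛ j)

    -- F is the time at which the server becomes free.  By ready-free, which holds
    -- because heads are nondecreasing, waiting for it delays a start at most to h + A.
    record Greedy (k : ℕ) : Set where
      field
        binary     : ∀ j → done j ≤ 1
        count      : sum done ≡ k
        closed     : ∀ i j → E i j → Done j → Done i
        heads      : ∀ j → Done j → IsHead j (H j)
        delays     : ∀ i j → E i j → Done j → C i + pₛ j ≤ C j
        spans      : ∀ j → Done j → pₛ j ≤ C j
        source     : Done s → C s ≡ 0
        terminal   : ∀ j → Done j → p꜀ j ≡ ⊤⁺ → side j ≡ 0
        disjoint   : ∀ i j → i ≢ j → Done i → Done j → Inner i → Inner j →
                     side i ≡ 0 → side j ≡ 0 → C i + pₛ j ≤ C j ⊎ C j + pₛ i ≤ C i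
        free       : ∀ j → Done j → Inner j → side j ≡ 0 → C j ≤ F
        bound      : ∀ j → Done j → C j ≤ H j + pₛ j + (A ∸ rem)
        ready-free : ∀ j → Ready j → ∀ h → IsHead j h → F ≤ h + A
        budget     : B + rem ≡ b

      release-bound : ∀ {j h r} → Ready j → IsHead j h → IsRelease j r → r ≤ h + (A ∸ rem)
      release-bound (_ , preds) (head≤ , _) (_ , least) = least _ λ i e →
        ≤-trans (bound i (preds i e)) (+-monoˡ-≤ (A ∸ rem) (head≤ i e))

    -- Pass from an unfinished job to an unfinished predecessor until there is none; acyclicity ends
    -- the descent.
    ready-exists : (∀ j → done j ≤ 1) → ∀ j → done j ≡ 0 → ∃[ i ] Ready i
    ready-exists binary j undone = go (E-wellFounded j) undone
      where
      go : ∀ {j} → Acc E j → done j ≡ 0 → ∃[ i ] Ready i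
      go {j} (acc rs) undone with Fin.any? (λ i → E? i j ×-dec (done i ≟ 0))
      ... | yes (i , e , undoneᵢ) = go (rs e) undoneᵢ
      ... | no none = j , undone , λ i e → ≤1∧≢0⇒≡1 (binary i) λ undoneᵢ → none (i , e , undoneᵢ)

    some-ready : ∀ {k} → Greedy k → k < n → ∃[ i ] Ready i
    some-ready g k<n with Fin.any? (λ j → done j ≟ 0)
    ... | yes (j , undone) = ready-exists (Greedy.binary g) j undone
    ... | no none = contradiction
      (≤-trans (sum≥n done λ j undone → none (j , undone)) (≤-reflexive (Greedy.count g))) (<⇒≱ k<n)

    all-done : Greedy n → ∀ j → Done j
    all-done g j = ≤1∧≢0⇒≡1 (binary j) λ undone → <-irrefl count (sum<n done binary j undone)
      where open Greedy g

  -- Preservation of the invariant when a ready job of least head is placed.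

  module Step
    {st st′ : State n} {k} (g : Greedy st k)
    {j₀ h r start σ} (ready : Ready st j₀) (head : IsHead st j₀ h) (release : IsRelease st j₀ r)
    (minimal : ∀ j → Ready st j → ∀ h′ → IsHead st j h′ → h ≤ h′)
    (done↑ : Updated (State.done st) j₀ 1 (State.done st′))
    (side↑ : Updated (State.side st) j₀ σ (State.side st′))
    (C↑    : Updated (State.C st) j₀ (start + pₛ j₀) (State.C st′))
    (H↑    : Updated (State.H st) j₀ h (State.H st′))
    where
    open State st
    open State st′ using () renaming (done to done′; side to side′; C to C′; H to H′; rem to rem′; F to F′)
    open Greedy g

    A⁺ : ℕ
    A⁺ = serverLoad (toSide σ) (pₛ j₀) + A st

    A′≡ : A st′ ≡ A⁺
    A′≡ = trans (sum-update _ _ j₀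
        (cong (λ d → doneServerLoad d (side j₀) (pₛ j₀)) (proj₁ ready))
        (λ i i≢j₀ → cong₂ (λ d τ → doneServerLoad d τ (pₛ i)) (proj₂ done↑ i i≢j₀) (proj₂ side↑ i i≢j₀)))
      (cong (_+ A st) (cong₂ (λ d τ → doneServerLoad d τ (pₛ j₀)) (proj₁ done↑) (proj₁ side↑)))

    B′≡ : B st′ ≡ cloudLoad (toSide σ) (pₛ j₀) + B st
    B′≡ = trans (sum-update _ _ j₀
        (cong (λ d → doneCloudLoad d (side j₀) (pₛ j₀)) (proj₁ ready))
        (λ i i≢j₀ → cong₂ (λ d τ → doneCloudLoad d τ (pₛ i)) (proj₂ done↑ i i≢j₀) (proj₂ side↑ i i≢j₀)))
      (cong (_+ B st) (cong₂ (λ d τ → doneCloudLoad d τ (pₛ j₀)) (proj₁ done↑) (proj₁ side↑)))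

    done⇒≢ : ∀ {i} → Done st i → i ≢ j₀
    done⇒≢ d refl with trans (sym d) (proj₁ ready)
    ... | ()

    old-or-new : ∀ i → Done st′ i → i ≡ j₀ ⊎ (i ≢ j₀ × Done st i)
    old-or-new i d with i Fin.≟ j₀
    ... | yes eq = inj₁ eq
    ... | no neq = inj₂ (neq , trans (sym (proj₂ done↑ i neq)) d)

    done-mono : ∀ {i} → Done st i → Done st′ i
    done-mono d = trans (proj₂ done↑ _ (done⇒≢ d)) d

    pred-done : ∀ i j → E i j → Done st′ j → Done st i
    pred-done i j e d with old-or-new j d
    ... | inj₁ refl    = proj₂ ready i e
    ... | inj₂ (_ , d) = closed i j e d

    C-old : ∀ {i} → Done st i → C′ i ≡ C i
    C-old d = proj₂ C↑ _ (done⇒≢ d)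

    H-old : ∀ {i} → Done st i → H′ i ≡ H i
    H-old d = proj₂ H↑ _ (done⇒≢ d)

    head-cong : ∀ {j x} → (∀ i → E i j → Done st i) → IsHead st j x → IsHead st′ j x
    head-cong preds = IsMax-cong λ i e → cong (_+ pₛ i) (sym (H-old (preds i e)))

    -- What a placement has to supply: the budget balance, bounds on the start and on the new `F`,
    -- and conditions for the terminals and for server jobs.
    module _
      (budget₀  : cloudLoad (toSide σ) (pₛ j₀) + rem′ ≡ rem)
      (start≥   : r ≤ start)
      (start≤   : start ≤ h + (A⁺ ∸ rem′))
      (F≤F′     : F ≤ F′)
      (F′≤      : F′ ≤ h + A⁺)
      (source₀  : j₀ ≡ s → start + pₛ j₀ ≡ 0)
      (terminal₀ : p꜀ j₀ ≡ ⊤⁺ → σ ≡ 0)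
      (server₀  : p꜀ j₀ ≢ ⊤⁺ → σ ≡ 0 → F ≤ start × start + pₛ j₀ ≤ F′)
      where

      -- The load only grows and the remaining budget only shrinks, so the bounds of the jobs
      -- already placed survive.
      A∸rem≤ : A st ∸ rem ≤ A st′ ∸ rem′
      A∸rem≤ = ∸-mono (subst (A st ≤_) (sym A′≡) (m≤n+m _ _)) (subst (rem′ ≤_) budget₀ (m≤n+m _ _))

      greedy-step : Greedy st′ (suc k)
      greedy-step = record
        { binary     = binary′
        ; count      = trans (sum-update done done′ j₀ (proj₁ ready) (proj₂ done↑)) (cong₂ _+_ (proj₁ done↑) count)
        ; closed     = λ i j e d → done-mono (pred-done i j e d)
        ; heads      = heads′
        ; delays     = delays′
        ; spans      = spans′
        ; source     = source′
        ; terminal   = terminal′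
        ; disjoint   = disjoint′
        ; free       = free′
        ; bound      = bound′
        ; ready-free = ready-free′
        ; budget     = budget′
        }
        where
        binary′ : ∀ j → done′ j ≤ 1
        binary′ j with j Fin.≟ j₀
        ... | yes refl = ≤-reflexive (proj₁ done↑)
        ... | no neq   = subst (_≤ 1) (sym (proj₂ done↑ j neq)) (binary j)

        heads′ : ∀ j → Done st′ j → IsHead st′ j (H′ j)
        heads′ j d with old-or-new j d
        ... | inj₁ refl =
          subst (IsHead st′ j) (sym (proj₁ H↑)) (head-cong (proj₂ ready) head)
        ... | inj₂ (_ , d₀) =
          subst (IsHead st′ j) (sym (H-old d₀)) (head-cong (λ i e → closed i j e d₀) (heads j d₀))

        delays′ : ∀ i j → E i j → Done st′ j → C′ i + pₛ j ≤ C′ j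
        delays′ i j e d with old-or-new j d
        ... | inj₁ refl rewrite C-old (proj₂ ready i e) | proj₁ C↑ =
          +-monoˡ-≤ (pₛ j) (≤-trans (proj₁ release i e) start≥)
        ... | inj₂ (_ , d₀) rewrite C-old (closed i j e d₀) | C-old d₀ = delays i j e d₀

        spans′ : ∀ j → Done st′ j → pₛ j ≤ C′ j
        spans′ j d with old-or-new j d
        ... | inj₁ refl rewrite proj₁ C↑ = m≤n+m _ _
        ... | inj₂ (_ , d₀) rewrite C-old d₀ = spans j d₀

        source′ : Done st′ s → C′ s ≡ 0
        source′ d with old-or-new s d
        ... | inj₁ refl = trans (proj₁ C↑) (source₀ refl)
        ... | inj₂ (_ , d₀) = trans (C-old d₀) (source d₀)

        terminal′ : ∀ j → Done st′ j → p꜀ j ≡ ⊤⁺ → side′ j ≡ 0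
        terminal′ j d ∞ with old-or-new j d
        ... | inj₁ refl = trans (proj₁ side↑) (terminal₀ ∞)
        ... | inj₂ (neq , d₀) = trans (proj₂ side↑ j neq) (terminal j d₀ ∞)

        fresh-disjoint : ∀ i → Done st i → Inner st i → Inner st j₀ → side′ i ≡ 0 → side′ j₀ ≡ 0 →
                         C′ i + pₛ j₀ ≤ C′ j₀
        fresh-disjoint i d inᵢ in₀ σᵢ σ₀ rewrite C-old d | proj₁ C↑ = +-monoˡ-≤ (pₛ j₀)
          (≤-trans (free i d inᵢ (trans (sym (proj₂ side↑ i (done⇒≢ d))) σᵢ))
            (proj₁ (server₀ in₀ (trans (sym (proj₁ side↑)) σ₀))))

        disjoint′ : ∀ i j → i ≢ j → Done st′ i → Done st′ j → Inner st i → Inner st j →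
                    side′ i ≡ 0 → side′ j ≡ 0 → C′ i + pₛ j ≤ C′ j ⊎ C′ j + pₛ i ≤ C′ i
        disjoint′ i j i≢j dᵢ dⱼ inᵢ inⱼ σᵢ σⱼ with old-or-new i dᵢ | old-or-new j dⱼ
        ... | inj₁ refl | inj₁ refl = contradiction refl i≢j
        ... | inj₁ refl | inj₂ (_ , d) = inj₂ (fresh-disjoint j d inⱼ inᵢ σⱼ σᵢ)
        ... | inj₂ (_ , d) | inj₁ refl = inj₁ (fresh-disjoint i d inᵢ inⱼ σᵢ σⱼ)
        ... | inj₂ (i≢ , d) | inj₂ (j≢ , d₀) rewrite C-old d | C-old d₀ =
          disjoint i j i≢j d d₀ inᵢ inⱼ (trans (sym (proj₂ side↑ i i≢)) σᵢ) (trans (sym (proj₂ side↑ j j≢)) σⱼ)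

        free′ : ∀ j → Done st′ j → Inner st j → side′ j ≡ 0 → C′ j ≤ F′
        free′ j d inⱼ σⱼ with old-or-new j d
        ... | inj₁ refl rewrite proj₁ C↑ = proj₂ (server₀ inⱼ (trans (sym (proj₁ side↑)) σⱼ))
        ... | inj₂ (neq , d₀) rewrite C-old d₀ =
          ≤-trans (free j d₀ inⱼ (trans (sym (proj₂ side↑ j neq)) σⱼ)) F≤F′

        bound′ : ∀ j → Done st′ j → C′ j ≤ H′ j + pₛ j + (A st′ ∸ rem′)
        bound′ j d with old-or-new j d
        ... | inj₂ (_ , d₀) rewrite C-old d₀ | H-old d₀ =
          ≤-trans (bound j d₀) (+-monoʳ-≤ (H j + pₛ j) A∸rem≤)
        ... | inj₁ refl rewrite proj₁ C↑ | proj₁ H↑ | A′≡ =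
          ≤-trans (+-monoˡ-≤ (pₛ j) start≤) (≤-reflexive (lemma h (A⁺ ∸ rem′) (pₛ j)))
          where
          lemma : ∀ a b c → a + b + c ≡ a + c + b
          lemma = solve-∀

        -- Why heads are nondecreasing over the rounds: a ready successor of `j₀` has head at least
        -- `h + pₛ j₀`, and any other ready job was ready before, when `j₀` had the least head.
        h≤ : ∀ j → Ready st′ j → ∀ h′ → IsHead st′ j h′ → h ≤ h′
        h≤ j (undone , preds) h′ head′ with E? j₀ j
        ... | yes e = subst (_≤ h′) (proj₁ H↑) (m+n≤o⇒m≤o _ (proj₁ head′ j₀ e))
        ... | no ¬e = minimal j
          (trans (sym (proj₂ done↑ j λ { refl → contradiction (trans (sym undone) (proj₁ done↑)) λ () })) undone ,
           λ i e → proj₂ (old i e))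
          h′ (IsMax-cong (λ i e → cong (_+ pₛ i) (proj₂ H↑ i (proj₁ (old i e)))) head′)
          where
          old : ∀ i → E i j → i ≢ j₀ × Done st i
          old i e with old-or-new i (preds i e)
          ... | inj₁ refl = contradiction e ¬e
          ... | inj₂ p    = p

        ready-free′ : ∀ j → Ready st′ j → ∀ h′ → IsHead st′ j h′ → F′ ≤ h′ + A st′
        ready-free′ j readyⱼ h′ head′ =
          ≤-trans F′≤ (+-mono-≤ (h≤ j readyⱼ h′ head′) (≤-reflexive (sym A′≡)))

        budget′ : B st′ + rem′ ≡ b
        budget′ = begin
          B st′ + rem′                ≡⟨ cong (_+ rem′) B′≡ ⟩
          x + B st + rem′             ≡⟨ lemma x (B st) rem′ ⟩
          B st + (x + rem′)           ≡⟨ cong (B st +_) budget₀ ⟩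
          B st + rem                  ≡⟨ budget ⟩
          b                           ∎
          where
          open ≡-Reasoning
          x = cloudLoad (toSide σ) (pₛ j₀)
          lemma : ∀ x y z → x + y + z ≡ y + (x + z)
          lemma = solve-∀

  -- The three placements: terminal, cloud and server.

  module Choose
    {st st′ : State n} {k} (g : Greedy st k)
    {j₀ h r} (ready : Ready st j₀) (head : IsHead st j₀ h) (release : IsRelease st j₀ r)
    (minimal : ∀ j → Ready st j → ∀ h′ → IsHead st j h′ → h ≤ h′)
    (done↑ : Updated (State.done st) j₀ 1 (State.done st′))
    (H↑    : Updated (State.H st) j₀ h (State.H st′))
    where
    open State st
    open State st′ using () renaming (side to side′; C to C′; rem to rem′; F to F′)
    open Greedy g

    r≤ : r ≤ h + (A st ∸ rem)
    r≤ = release-bound ready head release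

    F≤ : F ≤ h + A st
    F≤ = ready-free j₀ ready h head

    inner⇒≢s : Inner st j₀ → j₀ ≢ s
    inner⇒≢s inn refl = inn p꜀-s

    choose-terminal : p꜀ j₀ ≡ ⊤⁺ → pₛ j₀ ≡ 0 →
      Updated side j₀ 0 side′ → Updated C j₀ (r + pₛ j₀) C′ → rem′ ≡ rem → F′ ≡ F → Greedy st′ (suc k)
    choose-terminal ∞ p≡0 side↑ C↑ refl refl =
      Step.greedy-step {st} {st′} g ready head release minimal done↑ side↑ C↑ H↑
        refl ≤-refl
        (≤-trans r≤ (+-monoʳ-≤ h (∸-monoˡ-≤ rem (m≤n+m (A st) (pₛ j₀)))))
        ≤-refl (≤-trans F≤ (+-monoʳ-≤ h (m≤n+m (A st) (pₛ j₀))))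
        -- The release of `s` is a maximum over no predecessors, hence 0.
        (λ { refl → cong₂ _+_ (n≤0⇒n≡0 (proj₂ release 0 λ i e → contradiction e (s-source i))) p≡0 })
        (λ _ → refl) (λ inn _ → contradiction ∞ inn)

    -- The load is unchanged and `rem` does not grow, so the allowed delay does not shrink, and the
    -- release already met the old one.
    choose-cloud : Inner st j₀ → pₛ j₀ ≤ rem →
      Updated side j₀ 1 side′ → Updated C j₀ (r + pₛ j₀) C′ → rem′ ≡ rem ∸ pₛ j₀ → F′ ≡ F → Greedy st′ (suc k)
    choose-cloud inn p≤rem side↑ C↑ refl refl =
      Step.greedy-step {st} {st′} g ready head release minimal done↑ side↑ C↑ H↑
        (m+[n∸m]≡n p≤rem) ≤-refl
        (≤-trans r≤ (+-monoʳ-≤ h (∸-monoʳ-≤ (A st) (m∸n≤m rem (pₛ j₀)))))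
        ≤-refl F≤
        (λ j₀≡s → contradiction j₀≡s (inner⇒≢s inn))
        (λ ∞ → contradiction ∞ inn) (λ _ ())

    -- `r` and `F` are both at most `h + A`, hence so is the start. As `rem` is at most `pₛ j₀`, the
    -- old load `A` is at most the new load minus `rem`, which gives the required bound.
    choose-server : ∀ {start} → Inner st j₀ → rem ≤ pₛ j₀ →
      r ≤ start → F ≤ start → (∀ x → r ≤ x → F ≤ x → start ≤ x) →
      Updated side j₀ 0 side′ → Updated C j₀ (start + pₛ j₀) C′ → rem′ ≡ rem → F′ ≡ start + pₛ j₀ →
      Greedy st′ (suc k)
    choose-server {start} inn rem≤p r≤start F≤start start≤ side↑ C↑ refl refl =
      Step.greedy-step {st} {st′} g ready head release minimal done↑ side↑ C↑ H↑
        refl r≤start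
        (≤-trans start≤h+A (+-monoʳ-≤ h (m+n≤o⇒m≤o∸n _
          (≤-trans (+-monoʳ-≤ (A st) rem≤p) (≤-reflexive (+-comm (A st) (pₛ j₀)))))))
        (≤-trans F≤start (m≤m+n start (pₛ j₀)))
        (≤-trans (+-monoˡ-≤ (pₛ j₀) start≤h+A) (≤-reflexive (lemma h (A st) (pₛ j₀))))
        (λ j₀≡s → contradiction j₀≡s (inner⇒≢s inn))
        (λ _ → refl) (λ _ _ → F≤start , ≤-refl)
      where
      start≤h+A : start ≤ h + A st
      start≤h+A = start≤ (h + A st) (≤-trans r≤ (+-monoʳ-≤ h (m∸n≤m (A st) rem))) F≤
      lemma : ∀ x y z → x + y + z ≡ x + (z + y)
      lemma = solve-∀

  greedy-start : ∀ {st} → (∀ j → State.done st j ≡ 0) → State.F st ≡ 0 → State.rem st ≡ b → Greedy st 0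
  greedy-start {st} undone F≡0 rem≡b = record
    { binary     = λ j → ≤-trans (≤-reflexive (undone j)) z≤n
    ; count      = sum-zero done undone
    ; closed     = λ i j _ d → absurd j d
    ; heads      = λ j d → absurd j d
    ; delays     = λ i j _ d → absurd j d
    ; spans      = λ j d → absurd j d
    ; source     = λ d → absurd s d
    ; terminal   = λ j d → absurd j d
    ; disjoint   = λ i j _ d → absurd i d
    ; free       = λ j d → absurd j d
    ; bound      = λ j d → absurd j d
    ; ready-free = λ _ _ _ _ → ≤-trans (≤-reflexive F≡0) z≤n
    ; budget     = cong₂ _+_
        (sum-zero _ λ j → cong (λ d → doneCloudLoad d (side j) (pₛ j)) (undone j)) rem≡b
    }
    where
    open State st
    absurd : ∀ {X : Set} j → Done st j → X
    absurd j d = contradiction (trans (sym (undone j)) d) λ ()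

  -- Feasibility and approximation ratio of the final schedule.

  module Final (zeroDelays : ZeroDelays I) (identical : IdenticalMachines I)
               {st : State n} (g : Greedy st n) where
    open State st
    open Greedy g
    π : Schedule n
    π = schedule st

    all : ∀ j → Done st j
    all = all-done st g

    data Kind (j : Job) : Set where
      is-s  : j ≡ s → Kind j
      is-t  : j ≡ t → Kind j
      inner : Inner st j → p꜀ j ≡ [ pₛ j ]⁺ → Kind j

    kind : ∀ j → Kind j
    kind j with j Fin.≟ s | j Fin.≟ t
    ... | yes j≡s | _ = is-s j≡s
    ... | no _ | yes j≡t = is-t j≡t
    ... | no j≢s | no j≢t = inner (λ ∞ → contradiction (trans (sym ∞) eq) λ ()) eq
      where eq = identical j j≢s j≢t

    cloud⇒finite : ∀ j → toSide (side j) ≡ cloud → p꜀ j ≡ [ pₛ j ]⁺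
    cloud⇒finite j σ with kind j
    ... | is-s refl rewrite terminal s (all s) p꜀-s = contradiction σ λ ()
    ... | is-t refl rewrite terminal t (all t) p꜀-t = contradiction σ λ ()
    ... | inner _ eq = eq

    start : ∀ {x} j → x + pₛ j ≤ C j → _≤start_ I π x j
    start j le rewrite p-finite π j (cloud⇒finite j) = [ le ]

    server⇒0 : ∀ j → toSide (side j) ≡ server → side j ≡ 0
    server⇒0 j σ with side j
    ... | zero = refl

    C≤Ct : ∀ j → C j ≤ C t
    C≤Ct = max-at-sink C λ i j e → m+n≤o⇒m≤o (C i) (delays i j e (all j))

    -- The invariant covers pairs of inner jobs. `s` ends at 0, and `t` has length 0 and the largest
    -- completion time, so neither can overlap another job.
    server-disjoint : ∀ i j → i ≢ j → toSide (side i) ≡ server → toSide (side j) ≡ server →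
                      C i + pₛ j ≤ C j ⊎ C j + pₛ i ≤ C i
    server-disjoint i j i≢j σᵢ σⱼ with kind i | kind j
    ... | is-s refl | _ rewrite source (all s) = inj₁ (spans j (all j))
    ... | _ | is-s refl rewrite source (all s) = inj₂ (spans i (all i))
    ... | is-t refl | _ rewrite pₛ-t = inj₂ (subst (_≤ C t) (sym (+-identityʳ (C j))) (C≤Ct j))
    ... | _ | is-t refl rewrite pₛ-t = inj₁ (subst (_≤ C t) (sym (+-identityʳ (C i))) (C≤Ct i))
    ... | inner inᵢ _ | inner inⱼ _ =
      disjoint i j i≢j (all i) (all j) inᵢ inⱼ (server⇒0 i σᵢ) (server⇒0 j σⱼ)

    valid : Valid I π
    valid = record
      { server-disjoint = λ i j i≢j σᵢ σⱼ →
          [ (λ le → inj₁ (start j le)) , (λ le → inj₂ (start i le)) ]′ (server-disjoint i j i≢j σᵢ σⱼ)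
      ; same-side       = λ i j e _ → start j (delays i j e (all j))
      ; different-sides = λ i j d cij _ → start j
          (subst (λ x → x + pₛ j ≤ C j)
            (sym (trans (cong (C i +_) (zeroDelays i j d cij)) (+-identityʳ (C i))))
            (delays i j (d , cij) (all j)))
      }

    A≡ : A st ≡ sum (λ j → serverLoad (toSide (side j)) (pₛ j))
    A≡ = sum-cong-≗ λ j → cong (λ d → doneServerLoad d (side j) (pₛ j)) (all j)

    B≡ : B st ≡ sum (λ j → cloudLoad (toSide (side j)) (pₛ j))
    B≡ = sum-cong-≗ λ j → cong (λ d → doneCloudLoad d (side j) (pₛ j)) (all j)

    affordable : cost I π ≤⁺ [ b ]⁺
    affordable = subst (_≤⁺ [ b ]⁺)
      (sym (foldr-⊕-just (cloudCost I π) _ λ j → cloudCost-finite π j (cloud⇒finite j)))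
      [ subst₂ _≤_ B≡ budget (m≤m+n (B st) rem) ]

    -- `A + B` is the total load, hence at most the makespan plus `b`, and `b` equals `B + rem`;
    -- then `B` cancels.
    A∸rem≤makespan : ∀ π′ → FeasibleFor I π′ b → A st ∸ rem ≤ makespan I π′
    A∸rem≤makespan π′ feasible = m≤n+o⇒m∸n≤o _ rem (+-cancelʳ-≤ (B st) _ _ (begin
      A st + B st                  ≡⟨ cong₂ _+_ A≡ B≡ ⟩
      _                            ≡⟨ load-split (Schedule.side π) ⟨
      sum pₛ                       ≤⟨ LowerBounds.total-load zeroDelays identical π′ feasible ⟩
      makespan I π′ + b            ≡⟨ cong (makespan I π′ +_) budget ⟨
      makespan I π′ + (B st + rem) ≡⟨ lemma (makespan I π′) (B st) rem ⟩
      rem + makespan I π′ + B st   ∎))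
      where
      open ≤-Reasoning
      lemma : ∀ x y z → x + (y + z) ≡ z + x + y
      lemma = solve-∀

    approximation : IsApproximation I 2 b π
    approximation = (valid , affordable) , λ π′ feasible → begin
      C t
        ≤⟨ bound t (all t) ⟩
      H t + pₛ t + (A st ∸ rem)
        ≤⟨ +-mono-≤ (LowerBounds.head-≤ zeroDelays identical π′ feasible H (λ j → heads j (all j)) t)
             (A∸rem≤makespan π′ feasible) ⟩
      makespan I π′ + makespan I π′
        ≡⟨ cong (makespan I π′ +_) (+-identityʳ _) ⟨
      2 * makespan I π′ ∎
      where open ≤-Reasoning

-- The input encoding

cells-++ˡ : ∀ {m} (f : Fin m → ℕ) ys j → cells (List.tabulate f ++ ys) (toℕ j) ≡ f j
cells-++ˡ f ys zero    = refl
cells-++ˡ f ys (suc j) = cells-++ˡ (f ∘ suc) ys j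

cells-++ʳ : ∀ {m} (f : Fin m → ℕ) ys k → cells (List.tabulate f ++ ys) (m + k) ≡ cells ys k
cells-++ʳ {zero}  f ys k = refl
cells-++ʳ {suc m} f ys k = cells-++ʳ (f ∘ suc) ys k

cells-concat : ∀ {l m} (f : Fin l → Fin m → ℕ) i j →
  cells (List.concat (List.tabulate λ i → List.tabulate (f i))) (toℕ i * m + toℕ j) ≡ f i j
cells-concat f zero j = cells-++ˡ (f zero) _ j
cells-concat {suc l} {m} f (suc i) j rewrite +-assoc m (toℕ i * m) (toℕ j) =
  trans (cells-++ʳ (f zero) _ (toℕ i * m + toℕ j)) (cells-concat (f ∘ suc) i j)

-- The `1 +` is for cells past the end, whose 0 still has one digit.
cells-width : ∀ xs k → bits (cells xs k) ≤ 1 + size xs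
cells-width []       k       = ≤-refl
cells-width (x ∷ xs) zero    = m≤n⇒m≤1+n (m≤m+n _ _)
cells-width (x ∷ xs) (suc k) = ≤-trans (cells-width xs k) (s≤s (m≤n+m _ _))

size-++ : ∀ xs ys → size (xs ++ ys) ≡ size xs + size ys
size-++ xs ys = trans (cong listSum (map-++ bits xs ys)) (sum-++ (List.map bits xs) (List.map bits ys))

size-tabulate : ∀ {m} (f : Fin m → ℕ) → m ≤ size (List.tabulate f)
size-tabulate {zero}  f = z≤n
size-tabulate {suc m} f = +-mono-≤ (s≤s z≤n) (size-tabulate (f ∘ suc))

-- The table of server times alone has `n` entries of at least one digit each. This lets the input
-- size stand in for the number of rounds of a loop.
n≤size : ∀ I b → Instance.n I ≤ size (encode I b)
n≤size I b = ≤-trans (size-tabulate pₛ) (≤-trans (m≤m+n _ _) (≤-trans (≤-reflexive (sym (size-++ (List.tabulate pₛ) _)))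
  (≤-trans (m≤n+m _ (bits b)) (≤-trans (m≤n+m _ (bits (toℕ t))) (≤-trans (m≤n+m _ (bits (toℕ s))) (m≤n+m _ (bits n)))))))
  where open Instance I

load-width : ∀ xs → Width (evalPoly (1 ∷ 1 ∷ []) (size xs)) (load xs)
load-width xs = width λ
  { zero    k → subst (λ w → bits (cells xs k) ≤ 1 + w) (sym (lemma (size xs))) (cells-width xs k)
  ; (suc a) k → s≤s z≤n }
  where
  lemma : ∀ x → x * (1 + x * 0) ≡ x
  lemma = solve-∀

<suc⇒<⊎≡ : ∀ {m} {i l : Fin m} → toℕ l < suc (toℕ i) → toℕ l < toℕ i ⊎ l ≡ i
<suc⇒<⊎≡ (s≤s l≤i) with m≤n⇒m<n∨m≡n l≤i
... | inj₁ l<i = inj₁ l<i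
... | inj₂ l≡i = inj₂ (Fin.toℕ-injective l≡i)

-- The maximum over the indices already visited, as the loop over predecessors maintains it.
IsMaxBelow : ∀ {m} → (Fin m → Set) → (Fin m → ℕ) → ℕ → ℕ → Set
IsMaxBelow P f k = IsMax (λ l → toℕ l < k × P l) f

max-start : ∀ {m} {P : Fin m → Set} {f} → IsMaxBelow P f 0 0
max-start = (λ _ ()) , λ _ _ → z≤n

max-end : ∀ {m} {P : Fin m → Set} {f x} → IsMaxBelow P f m x → IsMax P f x
max-end (upper , least) =
  (λ i Pi → upper i (Fin.toℕ<n i , Pi)) , λ x f≤x → least x λ i Pi → f≤x i (proj₂ Pi)

max-skip : ∀ {m} {P : Fin m → Set} {f x} i → ¬ P i → IsMaxBelow P f (toℕ i) x → IsMaxBelow P f (suc (toℕ i)) x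
max-skip {P = P} {f} {x} i ¬Pi (upper , least) =
  upper′ , λ y f≤y → least y λ l (l<i , Pl) → f≤y l (m≤n⇒m≤1+n l<i , Pl)
  where
  upper′ : ∀ l → toℕ l < suc (toℕ i) × P l → f l ≤ x
  upper′ l (l≤i , Pl) with <suc⇒<⊎≡ l≤i
  ... | inj₁ l<i  = upper l (l<i , Pl)
  ... | inj₂ refl = contradiction Pl ¬Pi

-- `m + (n ∸ m)` is the maximum of `m` and `n`, written with the two arithmetic operations of the
-- machine.
m+[n∸m]-least : ∀ {m n x} → m ≤ x → n ≤ x → m + (n ∸ m) ≤ x
m+[n∸m]-least {m} {n} m≤x n≤x with ≤-total m n
... | inj₁ m≤n rewrite m+[n∸m]≡n m≤n = n≤x
... | inj₂ n≤m rewrite m≤n⇒m∸n≡0 n≤m | +-identityʳ m = m≤x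

max-raise : ∀ {m} {P : Fin m → Set} {f x y} i → P i → y ≡ f i →
            IsMaxBelow P f (toℕ i) x → IsMaxBelow P f (suc (toℕ i)) (x + (y ∸ x))
max-raise {P = P} {f} {x} i Pi refl (upper , least) =
  upper′ , λ y f≤y → m+[n∸m]-least
    (least y λ l (l<i , Pl) → f≤y l (m≤n⇒m≤1+n l<i , Pl)) (f≤y i (≤-refl , Pi))
  where
  upper′ : ∀ l → toℕ l < suc (toℕ i) × P l → f l ≤ x + (f i ∸ x)
  upper′ l (l≤i , Pl) with <suc⇒<⊎≡ l≤i
  ... | inj₁ l<i  = ≤-trans (upper l (l<i , Pl)) (m≤m+n x _)
  ... | inj₂ refl = m≤n+m∸n (f l) x

-- The program

sideA CA headA doneA remV freeV roundV jobV predV edgeV headV releaseV waitV foundV bestV bestHeadV bestReleaseV : ℕ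
sideA = 1
CA = 2
headA = 3
doneA = 4
remV = 5
freeV = 6
roundV = 7
jobV = 8
predV = 9
edgeV = 10
headV = 11
releaseV = 12
waitV = 13
foundV = 14
bestV = 15
bestHeadV = 16
bestReleaseV = 17

infix 4 _←_

_←_ : ℕ → Expr → Cmd
a ← e = a ⟦ lit 0 ⟧← e

raise : ℕ → Expr → Cmd
raise a e = a ← var a ⊞ (e ⊟ var a)

-- Input layout: four header cells, the server times, the cloud times from `4 + n` on, and from
-- `4 + (n + n)` on the edge table, row by row.
processing : Expr → Expr
processing j = 0 ⟦ lit 4 ⊞ j ⟧

cloudProcessing : Expr → Expr
cloudProcessing j = 0 ⟦ lit 4 ⊞ (var 0 ⊞ j) ⟧

-- `edgeV` holds the address of the entry for the edge from `predV` to `jobV`; adding `n` moves it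
-- down one row. `waitV` becomes 1 once an unfinished predecessor is met.
scan : Cmd
scan =
  (when 0 ⟦ var edgeV ⟧
   then (raise headV (headA ⟦ var predV ⟧ ⊞ processing (var predV)) ▹
         raise releaseV (CA ⟦ var predV ⟧) ▹
         raise waitV (lit 1 ⊟ doneA ⟦ var predV ⟧))
   else nop) ▹
  edgeV ← var edgeV ⊞ var 0

prepare : Cmd
prepare =
  headV ← lit 0 ▹ releaseV ← lit 0 ▹ waitV ← lit 0 ▹
  edgeV ← lit 4 ⊞ (var 0 ⊞ (var 0 ⊞ var jobV))

-- The outer test is nonzero if the job is finished or waits for a predecessor, the inner one if
-- nothing was found yet or the head is smaller than the best.
improve : Cmd
improve =
  when var waitV ⊞ doneA ⟦ var jobV ⟧
  then nop
  else (when (lit 1 ⊟ var foundV) ⊞ (var bestHeadV ⊟ var headV)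
        then (foundV ← lit 1 ▹ bestV ← var jobV ▹ bestHeadV ← var headV ▹ bestReleaseV ← var releaseV)
        else nop)

candidate : Cmd
candidate = prepare ▹ (for predV loop scan) ▹ improve

-- The jobs s and t are not appended to the server: they have length 0 and lie at
-- the two ends of the schedule, so they cannot overlap with a server job.
onServer onCloud onTerminal place : Cmd
onServer =
  freeV ← var bestReleaseV ⊞ (var freeV ⊟ var bestReleaseV) ⊞ processing (var bestV) ▹
  CA ⟦ var bestV ⟧← var freeV ▹
  sideA ⟦ var bestV ⟧← lit 0
onCloud =
  remV ← var remV ⊟ processing (var bestV) ▹
  CA ⟦ var bestV ⟧← var bestReleaseV ⊞ processing (var bestV) ▹
  sideA ⟦ var bestV ⟧← lit 1
onTerminal =
  CA ⟦ var bestV ⟧← var bestReleaseV ⊞ processing (var bestV) ▹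
  sideA ⟦ var bestV ⟧← lit 0
place =
  -- Code 0 is an infinite cloud time, so the last case is that of `s` and `t`; a nonzero difference
  -- means that the job does not fit in the remaining budget.
  when cloudProcessing (var bestV)
  then (when processing (var bestV) ⊟ var remV then onServer else onCloud)
  else onTerminal

commit : Cmd
commit = headA ⟦ var bestV ⟧← var bestHeadV ▹ doneA ⟦ var bestV ⟧← lit 1 ▹ place

round : Cmd
round = foundV ← lit 0 ▹ (for jobV loop candidate) ▹ commit

algorithm : Cmd
algorithm = remV ← 0 ⟦ lit 3 ⟧ ▹ (for roundV loop round)

stateOf : ∀ {n} → Memory → State n
stateOf μ = record
  { done = λ j → μ doneA (toℕ j)
  ; side = λ j → μ sideA (toℕ j)
  ; C    = λ j → μ CA (toℕ j)
  ; H    = λ j → μ headA (toℕ j)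
  ; rem  = μ remV 0
  ; F    = μ freeV 0
  }

-- `μ₁` is an earlier memory agreeing with `μ` on array `a`. Thus each of several assignments to
-- different arrays is compared with the state at the beginning of the round.
updated : ∀ {n} {μ₁ : Memory} μ a {β v w} {j : Fin n} → β ≡ toℕ j → v ≡ w → (∀ k → μ a k ≡ μ₁ a k) →
          Updated (λ i → μ₁ a (toℕ i)) j w (λ i → (μ [ a , β ↦ v ]) a (toℕ i))
updated μ a {v = v} {j = j} refl refl agree =
  update-at μ a (toℕ j) v ,
  λ i i≢j → trans (update-index μ a v λ eq → i≢j (sym (Fin.toℕ-injective eq))) (agree (toℕ i))

-- The program carries out the greedy rounds.

module Correct (I : Instance) (b : ℕ) (identical : IdenticalMachines I) where
  open Instance I
  open Graph I
  open Invariant I b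

  record HasInput (μ : Memory) : Set where
    constructor has-input
    field
      input-cell : ∀ k → μ 0 k ≡ cells (encode I b) k

  open HasInput

  n-cell : ∀ {μ} → HasInput μ → μ 0 0 ≡ n
  n-cell input = input-cell input 0

  pₛ-cell : ∀ {μ} → HasInput μ → ∀ j → μ 0 (4 + toℕ j) ≡ pₛ j
  pₛ-cell input j = trans (input-cell input (4 + toℕ j)) (cells-++ˡ pₛ _ j)

  p꜀-cell : ∀ {μ} → HasInput μ → ∀ j → μ 0 (4 + (n + toℕ j)) ≡ code (p꜀ j)
  p꜀-cell input j = trans (input-cell input (4 + (n + toℕ j)))
    (trans (cells-++ʳ pₛ _ (toℕ j)) (cells-++ˡ (code ∘ p꜀) _ j))

  edge-cell : ∀ {μ} → HasInput μ → ∀ i j → μ 0 (4 + (n + (n + (toℕ i * n + toℕ j)))) ≡ code (c i j)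
  edge-cell input i j = trans (input-cell input _)
    (trans (cells-++ʳ pₛ _ _) (trans (cells-++ʳ (code ∘ p꜀) _ _) (cells-concat (λ i j → code (c i j)) i j)))

  code≢0⇒E : ∀ i j → code (c i j) ≢ 0 → E i j
  code≢0⇒E i j ≢0 with c i j
  ... | just d  = d , refl
  ... | nothing = contradiction refl ≢0

  code≡0⇒¬E : ∀ i j → code (c i j) ≡ 0 → ¬ E i j
  code≡0⇒¬E i j ≡0 (d , eq) rewrite eq = contradiction ≡0 λ ()

  waiting : State n → Job → ℕ
  waiting st i = 1 ∸ State.done st i

  record Scanned (st : State n) (j : Job) (k : ℕ) (edge head release wait : ℕ) : Set where
    field
      edge-address : edge ≡ 4 + (n + (n + (k * n + toℕ j)))
      head-max     : IsMaxBelow (λ i → E i j) (λ i → State.H st i + pₛ i) k head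
      release-max  : IsMaxBelow (λ i → E i j) (State.C st) k release
      wait-max     : IsMaxBelow (λ i → E i j) (waiting st) k wait

  next-edge : ∀ k j {e m} → e ≡ 4 + (n + (n + (k * n + j))) → m ≡ n → e + m ≡ 4 + (n + (n + (suc k * n + j)))
  next-edge k j refl refl = lemma n (k * n) j
    where
    lemma : ∀ n x j → 4 + (n + (n + (x + j))) + n ≡ 4 + (n + (n + (n + x + j)))
    lemma = solve-∀

  ScannedAt : State n → Job → ℕ → Memory → Set
  ScannedAt st j k ν = Scanned st j k (ν edgeV 0) (ν headV 0) (ν releaseV 0) (ν waitV 0)

  scan-step : ∀ (μ : Memory) j i (ν : Memory) → HasInput ν →
    (∀ k → ν headA k ≡ μ headA k) → (∀ k → ν CA k ≡ μ CA k) → (∀ k → ν doneA k ≡ μ doneA k) →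
    ν predV 0 ≡ toℕ i → ScannedAt (stateOf μ) j (toℕ i) ν →
    ScannedAt (stateOf μ) j (suc (toℕ i)) (advance predV (den scan ν))
  scan-step μ j i ν input head≡ C≡ done≡ pred sc =
    branch-elim (λ κ → ScannedAt (stateOf μ) j (suc (toℕ i)) (advance predV (den (edgeV ← var edgeV ⊞ var 0) κ)))
      (ν 0 (ν edgeV 0))
      (λ ≢0 → let e = code≢0⇒E i j (≢0 ∘ trans edge-value) in record
        { edge-address = next-edge (toℕ i) (toℕ j) edge-address (n-cell input)
        ; head-max     = max-raise i e
            (cong₂ _+_ (trans (cong (ν headA) pred) (head≡ (toℕ i))) (trans (cong (λ k → ν 0 (4 + k)) pred) (pₛ-cell input i)))
            head-max
        ; release-max  = max-raise i e (trans (cong (ν CA) pred) (C≡ (toℕ i))) release-max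
        ; wait-max     = max-raise i e (cong (1 ∸_) (trans (cong (ν doneA) pred) (done≡ (toℕ i)))) wait-max
        })
      (λ ≡0 → let ¬e = code≡0⇒¬E i j (trans (sym edge-value) ≡0) in record
        { edge-address = next-edge (toℕ i) (toℕ j) edge-address (n-cell input)
        ; head-max     = max-skip i ¬e head-max
        ; release-max  = max-skip i ¬e release-max
        ; wait-max     = max-skip i ¬e wait-max
        })
    where
    open Scanned sc
    edge-value : ν 0 (ν edgeV 0) ≡ code (c i j)
    edge-value = trans (cong (ν 0) edge-address) (edge-cell input i j)

  Selected : State n → ℕ → (best head release : ℕ) → Set
  Selected st k best head release =
    ∃[ j ] best ≡ toℕ j × Ready st j × IsHead st j head × IsRelease st j release ×
      (∀ i → toℕ i < k → Ready st i → ∀ h → IsHead st i h → head ≤ h)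

  Selection : State n → ℕ → (found best head release : ℕ) → Set
  Selection st k found best head release =
    (found ≡ 0 × (∀ i → toℕ i < k → ¬ Ready st i)) ⊎
    (found ≡ 1 × Selected st k best head release)

  SelectionAt : State n → ℕ → Memory → Set
  SelectionAt st k ν = Selection st k (ν foundV 0) (ν bestV 0) (ν bestHeadV 0) (ν bestReleaseV 0)

  selection-skip : ∀ {st} j {f β h r} → ¬ Ready st j →
                   Selection st (toℕ j) f β h r → Selection st (suc (toℕ j)) f β h r
  selection-skip {st} j ¬ready (inj₁ (f≡0 , none)) = inj₁ (f≡0 , none′)
    where
    none′ : ∀ i → toℕ i < suc (toℕ j) → ¬ Ready st i
    none′ i i≤j with <suc⇒<⊎≡ i≤j
    ... | inj₁ i<j  = none i i<j
    ... | inj₂ refl = ¬ready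
  selection-skip {st} j {h = h} ¬ready (inj₂ (f≡1 , i₀ , eq , rd , hd , rl , least)) =
    inj₂ (f≡1 , i₀ , eq , rd , hd , rl , least′)
    where
    least′ : ∀ i → toℕ i < suc (toℕ j) → Ready st i → ∀ h′ → IsHead st i h′ → h ≤ h′
    least′ i i≤j with <suc⇒<⊎≡ i≤j
    ... | inj₁ i<j  = least i i<j
    ... | inj₂ refl = λ ready → contradiction ready ¬ready

  selection-keep : ∀ {st} j {f β h r h₁} → IsHead st j h₁ → (1 ∸ f) + (h ∸ h₁) ≡ 0 →
                   Selection st (toℕ j) f β h r → Selection st (suc (toℕ j)) f β h r
  -- With nothing found yet, `1 ∸ f` is 1, so the test cannot be zero.
  selection-keep j hd₁ test (inj₁ (refl , none)) = contradiction test λ ()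
  selection-keep {st} j {h = h} hd₁ test (inj₂ (refl , i₀ , eq , rd , hd , rl , least)) =
    inj₂ (refl , i₀ , eq , rd , hd , rl , least′)
    where
    least′ : ∀ i → toℕ i < suc (toℕ j) → Ready st i → ∀ h′ → IsHead st i h′ → h ≤ h′
    least′ i i≤j with <suc⇒<⊎≡ i≤j
    ... | inj₁ i<j  = least i i<j
    -- `h₁` and `h′` are heads of the same job, so leastness of `h₁` compares them.
    ... | inj₂ refl = λ _ h′ hd′ → ≤-trans (m∸n≡0⇒m≤n test) (proj₂ hd₁ h′ (proj₁ hd′))

  selection-take : ∀ {st} j {f β h r β₁ h₁ r₁} → β₁ ≡ toℕ j → Ready st j → IsHead st j h₁ → IsRelease st j r₁ →
                   (1 ∸ f) + (h ∸ h₁) ≢ 0 →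
                   Selection st (toℕ j) f β h r → Selection st (suc (toℕ j)) 1 β₁ h₁ r₁
  selection-take {st} j {f} {h = h} {h₁ = h₁} β₁≡ rd hd rl test sel =
    inj₂ (refl , j , β₁≡ , rd , hd , rl , least′)
    where
    better : ∀ {β r} → Selection st (toℕ j) f β h r →
             ∀ i → toℕ i < toℕ j → Ready st i → ∀ h′ → IsHead st i h′ → h₁ ≤ h′
    better (inj₁ (_ , none)) i i<j rdᵢ h′ hd′ = contradiction rdᵢ (none i i<j)
    better (inj₂ (refl , _ , _ , _ , _ , _ , least)) i i<j rdᵢ h′ hd′ =
      ≤-trans (<⇒≤ (m∸n≢0⇒n<m test)) (least i i<j rdᵢ h′ hd′)

    least′ : ∀ i → toℕ i < suc (toℕ j) → Ready st i → ∀ h′ → IsHead st i h′ → h₁ ≤ h′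
    least′ i i≤j rdᵢ h′ hd′ with <suc⇒<⊎≡ i≤j
    ... | inj₁ i<j  = better sel i i<j rdᵢ h′ hd′
    ... | inj₂ refl = proj₂ hd h′ (proj₁ hd′)

  -- `waitV` holds the maximum of `1 ∸ done` over the predecessors, which is 0 exactly when all of
  -- them are finished.
  improve-step : ∀ (μ : Memory) → (∀ j → State.done {n} (stateOf μ) j ≤ 1) → ∀ j (ν : Memory) →
    ν jobV 0 ≡ toℕ j → (∀ k → ν doneA k ≡ μ doneA k) →
    ScannedAt (stateOf μ) j n ν → SelectionAt (stateOf μ) (toℕ j) ν →
    SelectionAt (stateOf μ) (suc (toℕ j)) (advance jobV (den improve ν))
  improve-step μ binary j ν job done≡ sc sel =
    branch-elim Goal (ν waitV 0 + ν doneA (ν jobV 0))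
      (λ ≢0 → selection-skip {stateOf μ} j (λ ready → ≢0 (not-waiting ready)) sel)
      (λ ≡0 → branch-elim Goal ((1 ∸ ν foundV 0) + (ν bestHeadV 0 ∸ ν headV 0))
        (λ test → selection-take {stateOf μ} j job (ready ≡0) (max-end head-max) (max-end release-max) test sel)
        (λ test → selection-keep {stateOf μ} j (max-end head-max) test sel))
    where
    open Scanned sc
    Goal : Memory → Set
    Goal κ = SelectionAt (stateOf μ) (suc (toℕ j)) (advance jobV κ)

    done-value : ν doneA (ν jobV 0) ≡ State.done {n} (stateOf μ) j
    done-value = trans (cong (ν doneA) job) (done≡ (toℕ j))

    not-waiting : Ready (stateOf μ) j → ν waitV 0 + ν doneA (ν jobV 0) ≡ 0
    not-waiting (undone , preds) = cong₂ _+_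
      (n≤0⇒n≡0 (proj₂ wait-max 0 λ i (_ , e) → ≤-reflexive (cong (1 ∸_) (preds i e))))
      (trans done-value undone)

    ready : ν waitV 0 + ν doneA (ν jobV 0) ≡ 0 → Ready (stateOf μ) j
    ready ≡0 =
      trans (sym done-value) (m+n≡0⇒n≡0 (ν waitV 0) ≡0) ,
      λ i e → ≤-antisym (binary i) (m∸n≡0⇒m≤n (n≤0⇒n≡0
        (≤-trans (proj₁ (max-end wait-max) i e) (≤-reflexive (m+n≡0⇒m≡0 (ν waitV 0) ≡0)))))

  candidate-step : ∀ (μ : Memory) → (∀ j → State.done {n} (stateOf μ) j ≤ 1) → ∀ j (ν : Memory) → HasInput ν →
    (∀ k → ν headA k ≡ μ headA k) → (∀ k → ν CA k ≡ μ CA k) → (∀ k → ν doneA k ≡ μ doneA k) →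
    ν jobV 0 ≡ toℕ j → SelectionAt (stateOf μ) (toℕ j) ν →
    SelectionAt (stateOf μ) (suc (toℕ j)) (advance jobV (den candidate ν))
  candidate-step μ binary j ν input head≡ C≡ done≡ job sel =
    improve-step μ binary j ν₂
      (trans (frame scanAll _ ν₁ 0) job)
      (λ k → trans (frame scanAll _ ν₁ k) (done≡ k))
      scanned
      (subst₂ (λ f β → Selection (stateOf μ) (toℕ j) f β (ν₂ bestHeadV 0) (ν₂ bestReleaseV 0))
        (sym (frame scanAll _ ν₁ 0)) (sym (frame scanAll _ ν₁ 0))
        (subst₂ (Selection (stateOf μ) (toℕ j) (ν foundV 0) (ν bestV 0))
          (sym (frame scanAll _ ν₁ 0)) (sym (frame scanAll _ ν₁ 0)) sel))
    where
    scanAll : Cmd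
    scanAll = for predV loop scan

    ν₁ ν₂ : Memory
    ν₁ = den prepare ν
    ν₂ = den scanAll ν₁

    scanned : ScannedAt (stateOf μ) j n ν₂
    scanned = for-invariant predV scan _ ν₁ (n-cell input) (ScannedAt (stateOf μ) j)
      (record
        { edge-address = cong₂ (λ x y → 4 + (x + (x + y))) (n-cell input) job
        ; head-max = max-start ; release-max = max-start ; wait-max = max-start })
      (λ i κ pred agree → scan-step μ j i κ
        (has-input λ k → trans (agree 0 _ k) (input-cell input k)) (λ k → trans (agree headA _ k) (head≡ k))
        (λ k → trans (agree CA _ k) (C≡ k)) (λ k → trans (agree doneA _ k) (done≡ k)) pred)

  commit-step : ∀ (μ ν : Memory) {k} → Greedy (stateOf μ) k → HasInput ν →
    (∀ k → ν headA k ≡ μ headA k) → (∀ k → ν CA k ≡ μ CA k) → (∀ k → ν doneA k ≡ μ doneA k) →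
    (∀ k → ν sideA k ≡ μ sideA k) → ν remV 0 ≡ μ remV 0 → ν freeV 0 ≡ μ freeV 0 →
    Selected (stateOf μ) n (ν bestV 0) (ν bestHeadV 0) (ν bestReleaseV 0) →
    Greedy (stateOf (den commit ν)) (suc k)
  commit-step μ ν {k} g input head≡ C≡ done≡ side≡ rem≡ free≡ (j , β≡ , ready , head , release , least) =
    -- `κ` differs from `ν` only in `headA` and `doneA`, so the tests of `place` read the same
    -- values in both.
    branch-elim Goal (ν 0 (4 + (ν 0 0 + ν bestV 0)))
      {branch (ν 0 (4 + ν bestV 0) ∸ ν remV 0) (den onServer κ) (den onCloud κ)} {den onTerminal κ}
      (λ ≢0 → branch-elim Goal (ν 0 (4 + ν bestV 0) ∸ ν remV 0) {den onServer κ} {den onCloud κ}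
        (λ rem<p → server-case (finite ≢0) (subst₂ _≤_ rem≡ p≡ (<⇒≤ (m∸n≢0⇒n<m rem<p))))
        (λ p≤rem → cloud-case (finite ≢0) (subst₂ _≤_ p≡ rem≡ (m∸n≡0⇒m≤n p≤rem))))
      (λ ≡0 → terminal-case (infinite ≡0))
    where
    κ : Memory
    κ = den (headA ⟦ var bestV ⟧← var bestHeadV ▹ doneA ⟦ var bestV ⟧← lit 1) ν

    Goal : Memory → Set
    Goal κ′ = Greedy (stateOf κ′) (suc k)

    r start : ℕ
    r = ν bestReleaseV 0
    start = r + (ν freeV 0 ∸ r)

    p≡ : ν 0 (4 + ν bestV 0) ≡ pₛ j
    p≡ = trans (cong (λ x → ν 0 (4 + x)) β≡) (pₛ-cell input j)

    p꜀≡ : ν 0 (4 + (ν 0 0 + ν bestV 0)) ≡ code (p꜀ j)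
    p꜀≡ = trans (cong₂ (λ x y → ν 0 (4 + (x + y))) (n-cell input) β≡) (p꜀-cell input j)

    finite : ν 0 (4 + (ν 0 0 + ν bestV 0)) ≢ 0 → p꜀ j ≢ ⊤⁺
    finite ≢0 ∞ = ≢0 (trans p꜀≡ (cong code ∞))

    infinite : ν 0 (4 + (ν 0 0 + ν bestV 0)) ≡ 0 → p꜀ j ≡ ⊤⁺
    infinite ≡0 with p꜀ j | trans (sym p꜀≡) ≡0
    ... | nothing | _ = refl

    infinite⇒p≡0 : p꜀ j ≡ ⊤⁺ → pₛ j ≡ 0
    infinite⇒p≡0 ∞ with j Fin.≟ s | j Fin.≟ t
    ... | yes refl | _ = pₛ-s
    ... | no _ | yes refl = pₛ-t
    ... | no j≢s | no j≢t = contradiction (trans (sym ∞) (identical j j≢s j≢t)) λ ()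

    least′ : ∀ i → Ready (stateOf μ) i → ∀ h → IsHead (stateOf μ) i h → ν bestHeadV 0 ≤ h
    least′ i = least i (Fin.toℕ<n i)

    done↑ : Updated (λ i → μ doneA (toℕ i)) j 1 (λ i → κ doneA (toℕ i))
    done↑ = updated {μ₁ = μ} (den (headA ⟦ var bestV ⟧← var bestHeadV) ν) doneA β≡ refl done≡

    head↑ : Updated (λ i → μ headA (toℕ i)) j (ν bestHeadV 0) (λ i → κ headA (toℕ i))
    head↑ = updated {μ₁ = μ} ν headA β≡ refl head≡

    κ₁ κ₂ κ₃ κ₄ κ₅ : Memory
    κ₁ = den (CA ⟦ var bestV ⟧← var bestReleaseV ⊞ processing (var bestV)) κ
    κ₂ = den (remV ← var remV ⊟ processing (var bestV)) κ
    κ₃ = den (CA ⟦ var bestV ⟧← var bestReleaseV ⊞ processing (var bestV)) κ₂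
    κ₄ = den (freeV ← var bestReleaseV ⊞ (var freeV ⊟ var bestReleaseV) ⊞ processing (var bestV)) κ
    κ₅ = den (CA ⟦ var bestV ⟧← var freeV) κ₄

    terminal-case : p꜀ j ≡ ⊤⁺ → Goal (den onTerminal κ)
    terminal-case ∞ = Choose.choose-terminal {stateOf μ} {stateOf (den onTerminal κ)}
      g ready head release least′ done↑ head↑ ∞ (infinite⇒p≡0 ∞)
      (updated {μ₁ = μ} κ₁ sideA β≡ refl side≡) (updated {μ₁ = μ} κ CA β≡ (cong (r +_) p≡) C≡) rem≡ free≡

    cloud-case : p꜀ j ≢ ⊤⁺ → pₛ j ≤ μ remV 0 → Goal (den onCloud κ)
    cloud-case inn p≤rem = Choose.choose-cloud {stateOf μ} {stateOf (den onCloud κ)}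
      g ready head release least′ done↑ head↑ inn p≤rem
      (updated {μ₁ = μ} κ₃ sideA β≡ refl side≡) (updated {μ₁ = μ} κ₂ CA β≡ (cong (r +_) p≡) C≡) (cong₂ _∸_ rem≡ p≡) free≡

    server-case : p꜀ j ≢ ⊤⁺ → μ remV 0 ≤ pₛ j → Goal (den onServer κ)
    server-case inn rem≤p = Choose.choose-server {stateOf μ} {stateOf (den onServer κ)}
      g ready head release least′ done↑ head↑ inn rem≤p
      (m≤m+n r _) (subst (_≤ start) free≡ (m≤n+m∸n (ν freeV 0) r))
      (λ x r≤x F≤x → m+[n∸m]-least r≤x (subst (_≤ x) (sym free≡) F≤x))
      (updated {μ₁ = μ} κ₅ sideA β≡ refl side≡) (updated {μ₁ = μ} κ₄ CA β≡ (cong (start +_) p≡) C≡) rem≡ (cong (start +_) p≡)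

  -- While fewer than `n` jobs are finished some job is ready, so the search cannot come back empty.
  round-step : ∀ (μ : Memory) {k} → HasInput μ → k < n → Greedy (stateOf μ) k → Greedy (stateOf (den round μ)) (suc k)
  round-step μ {k} input k<n g = commit-step μ ν₂ g
    (has-input λ k → trans (frame search _ ν₁ k) (input-cell input k))
    (frame search _ ν₁) (frame search _ ν₁) (frame search _ ν₁) (frame search _ ν₁)
    (frame search _ ν₁ 0) (frame search _ ν₁ 0)
    selected
    where
    search : Cmd
    search = for jobV loop candidate

    ν₁ ν₂ : Memory
    ν₁ = den (foundV ← lit 0) μ
    ν₂ = den search ν₁

    selection : SelectionAt (stateOf μ) n ν₂
    selection = for-invariant jobV candidate _ ν₁ (n-cell input) (SelectionAt (stateOf μ))
      (inj₁ (refl , λ _ ()))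
      (λ j κ job agree → candidate-step μ (Greedy.binary g) j κ
        (has-input λ k → trans (agree 0 _ k) (input-cell input k)) (agree headA _) (agree CA _) (agree doneA _) job)

    selected : Selected (stateOf μ) n (ν₂ bestV 0) (ν₂ bestHeadV 0) (ν₂ bestReleaseV 0)
    selected with selection
    ... | inj₂ (_ , sel) = sel
    ... | inj₁ (_ , none) with some-ready (stateOf μ) g k<n
    ...   | i , ready = contradiction ready (none i (Fin.toℕ<n i))

  algorithm-greedy : Greedy (stateOf (den algorithm (load (encode I b)))) n
  algorithm-greedy = for-invariant roundV round _ (den (remV ← 0 ⟦ lit 3 ⟧) (load (encode I b))) refl
    (λ k μ → Greedy (stateOf μ) k)
    (greedy-start (λ _ → refl) refl refl)
    (λ i ν _ agree → round-step ν (has-input λ k → agree 0 _ k) (Fin.toℕ<n i))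

theorem14 : Σ Program λ P → Σ (List ℕ) λ q →
    IsPolyTimeApproximationAlgorithm (λ I → ZeroDelays I × IdenticalMachines I) 2 P q
theorem14 = compile algorithm , duration algorithm (1 ∷ 1 ∷ []) , λ I (zeroDelays , identical) b →
  let input = encode I b
      -- Every cell of the loaded memory has at most one digit more than the input size, which is
      -- the polynomial `1 ∷ 1 ∷ []`.
      k , run , k≤ = runs algorithm _ _ (1 ∷ 1 ∷ []) (size input) (n≤size I b) (load-width input)
  in den algorithm (load input) , k , run , k≤ ,
     Invariant.Final.approximation I b zeroDelays identical (Correct.algorithm-greedy I b identical)
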